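{- Let $n\geq 5$ and let $\pi=(d_1,d_2,\ldots,d_n)$ be a nonincreasing sequence of positive integers that is graphic. Then $\pi$ is potentially $(K_5-C_4)$-graphic if and only if all of the following conditions hold: (1) $d_1\geq 4$; (2) $d_5\geq 2$; (3) if $n\geq 6$, then $\pi\neq((n-2)^2,2^{n-2})$; (4) $\pi\neq(n-k,\,k+i,\,2^i,\,1^{n-i-2})$ for all integers $k$ and $i$ with $k\in\{1,2,\ldots,\lfloor\frac{n-1}{2}\rfloor-1\}$ and $i\in\{3,4,\ldots,n-2k\}$; (5) if $n=6$, then $\pi\neq(4,2^5)$; (6) if $n=7$, then $\pi\neq(4,2^6)$.
   Context: All graphs are finite and simple. A nonincreasing sequence $\pi=(d_1,\ldots,d_n)$ of nonnegative integers is graphic if it is the degree sequence of a simple graph $G$ on $n$ vertices; such a $G$ is called a realization of $\pi$. For a simple graph $H$, a graphic sequence $\pi$ is potentially $H$-graphic if it has a realization $G$ containing $H$ as a (not necessarily induced) subgraph. $K_5-C_4$ denotes the graph on 5 vertices obtained from the complete graph $K_5$ by removing the four edges of a cycle $C_4$ of length 4 (equivalently, two triangles sharing exactly one common vertex). In writing sequences, the symbol $x^y$ stands for $y$ consecutive terms equal to $x$ (so $x^0$ means no terms); for example $((n-2)^2,2^{n-2})$ is the sequence with two terms equal to $n-2$ followed by $n-2$ terms equal to $2$. -}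

module Defs where

open import Data.Fin using (Fin; _≟_)
open import Data.Fin.Patterns using (0F; 1F; 2F; 3F)
open import Data.List using (List; []; _∷_)
open import Data.List.Membership.Propositional using (_∈_; _∉_)
open import Data.Nat using (ℕ; _≥_)
open import Data.Product using (_×_; _,_; ∃; Σ-syntax)
open import Data.Product.Properties using (≡-dec)
open import Data.Vec using (Vec; lookup; allFin; count)
open import Data.Vec.Functional.Relation.Binary.Permutation using (_↭_)
open import Data.Vec.Relation.Unary.Linked using (Linked)
open import Function.Definitions using (Injective)
open import Level using (0ℓ)
open import Relation.Binary using (Rel; Decidable; Symmetric; Irreflexive)
open import Relation.Binary.PropositionalEquality using (_≡_; _≢_; refl; sym)
open import Relation.Nullary.Decidable using (_×-dec_; ¬?)

import Data.List.Membership.DecPropositional as DecMembership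

-- Decidability of adjacency is part of the structure: it is what makes
-- degrees computable, and it holds classically for every finite graph.

record Graph (n : ℕ) : Set₁ where
  field
    Adj        : Rel (Fin n) 0ℓ
    adj?       : Decidable Adj
    adj-sym    : Symmetric Adj
    adj-irrefl : Irreflexive _≡_ Adj

  degree : Fin n → ℕ
  degree v = count (adj? v) (allFin n)

open Graph public

-- Not necessarily induced: edges of H must be preserved, non-edges need not be.

infix 4 _⊑_

_⊑_ : ∀ {m n} → Graph m → Graph n → Set
_⊑_ {m} {n} H G =
  Σ[ f ∈ (Fin m → Fin n) ]
    Injective _≡_ _≡_ f × (∀ {u v} → Adj H u v → Adj G (f u) (f v))

complete : ∀ n → Graph n
complete n = record
  { Adj        = _≢_
  ; adj?       = λ u v → ¬? (u ≟ v)
  ; adj-sym    = λ u≢v v≡u → u≢v (sym v≡u)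
  ; adj-irrefl = λ u≡v u≢v → u≢v u≡v
  }

-- A pair (u , v) in the list stands for the unordered edge uv.

deleteEdges : ∀ {n} → Graph n → List (Fin n × Fin n) → Graph n
deleteEdges {n} G es = record
  { Adj        = λ u v → Adj G u v × (u , v) ∉ es × (v , u) ∉ es
  ; adj?       = λ u v → adj? G u v ×-dec ¬? ((u , v) ∈? es) ×-dec ¬? ((v , u) ∈? es)
  ; adj-sym    = λ (uv , uv∉es , vu∉es) → adj-sym G uv , vu∉es , uv∉es
  ; adj-irrefl = λ u≡v (uv , _) → adj-irrefl G u≡v uv
  }
  where open DecMembership (≡-dec (_≟_ {n}) _≟_) using (_∈?_)

K₅-C₄ : Graph 5
K₅-C₄ = deleteEdges (complete 5) ((0F , 1F) ∷ (1F , 2F) ∷ (2F , 3F) ∷ (3F , 0F) ∷ [])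

NonIncreasing : ∀ {n} → Vec ℕ n → Set
NonIncreasing = Linked _≥_

-- The terms of π are the degrees of G with multiplicity; the vertices of G
-- need not be numbered by decreasing degree.

_Realizes_ : ∀ {n} → Graph n → Vec ℕ n → Set
G Realizes π = lookup π ↭ degree G

Graphic : ∀ {n} → Vec ℕ n → Set₁
Graphic π = ∃ λ G → G Realizes π

Potentially_-Graphic : ∀ {m n} → Graph m → Vec ℕ n → Set₁
Potentially_-Graphic H π = ∃ λ G → G Realizes π × H ⊑ G

{-# OPTIONS --safe #-}

-- Sufficiency.  A switch (replacing edges ij and kl by ik and jl) keeps all
-- degrees, so a realization may be rebuilt on a few of its vertices at a time.
-- Switches first give a vertex v of degree at least four four neighbours of
-- degree at least two.  A case analysis on these and their further neighbours
-- leads by switches to a butterfly K₅ − C₄ or to one of four induced subgraphs: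
-- K₂,₄, the book K₁,₁,₃, or a triangle sharing one vertex with a 4-cycle or with
-- a 5-cycle.  Any further vertex or edge next to one of these allows switches to
-- a butterfly, unless it merely enlarges the K₂,₄ or adds a page or a leaf at the
-- spine of the book; hence the whole graph has an exceptional degree sequence.
--
-- Necessity.  No two vertices cover all edges of a butterfly, so the degrees of
-- any two vertices add up to at most the number of edges, which rules out (4).
-- In the other exceptional sequences the butterfly saturates its vertices of
-- degree two, which leaves too few neighbours for some other vertex.

module Submission where

open import Data.Bool using (Bool; true; false; T; if_then_else_; not; _∧_; _∨_)
open import Data.Bool.ListAction using (all; any)
open import Data.Bool.Properties using (T-∧)
open import Data.Empty using (⊥; ⊥-elim)
open import Data.Fin using (Fin; zero; suc; _≟_; toℕ; fromℕ<; inject≤; punchIn)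
open import Data.Fin.Patterns
open import Data.Fin.Permutation using (Permutation; _⟨$⟩ʳ_; _⟨$⟩ˡ_; inverseˡ; inverseʳ)
open import Data.Fin.Properties
  using (all?; toℕ-inject≤; inject≤-injective; pigeonhole; toℕ-injective; fromℕ<-injective)
open import Data.List as List using (List; []; _∷_; _++_; map; length; replicate; allFin; filterᵇ)
open import Data.List.Membership.DecPropositional using (_∈?_)
open import Data.List.Membership.Propositional using (_∈_; _∉_; find; lose)
open import Data.List.Membership.Propositional.Properties using (∈-∃++; ∈-allFin)
open import Data.List.Properties
  using ( map-cong; map-cong-local; map-++; map-∘; map-tabulate; length-++; length-map; length-replicate
        ; length-tabulate; ++-identityʳ; ∷-injective)
open import Data.List.Relation.Binary.Equality.Propositional using (≋⇒≡)
open import Data.List.Relation.Binary.Permutation.Propositional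
  using (_↭_; ↭-refl; ↭-sym; ↭-trans; ↭-reflexive; ↭⇒↭ₛ; prep; swap)
open import Data.List.Relation.Binary.Subset.Propositional using (_⊆_)
open import Data.List.Relation.Unary.All as All using (All; []; _∷_)
open import Data.List.Relation.Unary.All.Properties as AllP using (++⁺; ++⁻ʳ; all⁺)
open import Data.List.Relation.Unary.AllPairs using ([]; _∷_)
open import Data.List.Relation.Unary.Any using (here; there; any?)
open import Data.List.Relation.Unary.Any.Properties using (any⁻)
open import Data.List.Relation.Unary.Linked using (Linked; []; [-]; _∷_)
open import Data.List.Relation.Unary.Sorted.TotalOrder.Properties using (↗↭↗⇒≋)
open import Data.List.Relation.Unary.Unique.Propositional using (Unique)
open import Data.List.Relation.Unary.Unique.Propositional.Properties using (allFin⁺; Unique[x∷xs]⇒x∉xs)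
open import Data.Nat hiding (_≟_)
open import Data.Nat.DivMod using (/-monoˡ-≤; m*n/n≡m)
open import Data.Nat.ListAction using (sum)
open import Data.Nat.ListAction.Properties using (sum-++; sum-↭)
open import Data.Nat.Properties hiding (_≟_)
open import Data.Nat.Tactic.RingSolver using (solve-∀)
open import Data.Product using (∃; ∃₂; _×_; _,_; proj₁; proj₂)
open import Data.Sum using (_⊎_; inj₁; inj₂; [_,_]′)
open import Data.Vec as Vec using (Vec; []; _∷_; lookup; toList)
open import Data.Vec.Properties using (lookup-map; length-toList)
open import Data.Vec.Relation.Unary.All as VecAll using ([]; _∷_)
open import Data.Vec.Relation.Unary.AllPairs as VecAllPairs using ([]; _∷_)
open import Data.Vec.Relation.Unary.Linked using ([]; [-]; _∷_)
open import Data.Vec.Relation.Unary.Linked.Properties using (lookup⁺)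
open import Data.Vec.Relation.Unary.Unique.Propositional renaming (Unique to Uniqueᵛ) using ()
open import Data.Vec.Relation.Unary.Unique.Propositional.Properties using (lookup-injective)
open import Function using (_∘_; id)
open import Function.Bundles using (Equivalence; _⇔_; mk⇔)
open import Relation.Binary.Properties.TotalOrder ≤-totalOrder using (≥-totalOrder)
open import Relation.Binary.PropositionalEquality
open import Relation.Nullary using (Dec; does; yes; no; ¬_; contradiction)
open import Relation.Nullary.Decidable
  using (⌊_⌋; ¬?; T?; _×-dec_; _⊎-dec_; _→-dec_; dec-true; dec-false; does-⇔; from-yes; toWitness; toWitnessFalse)

import Data.List.Relation.Binary.Permutation.Propositional.Properties as Perm
import Data.List.Relation.Binary.Permutation.Setoid.Properties as PermSetoid
import Data.List.Relation.Unary.Unique.Propositional.Properties as UniqueP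
import Data.Vec.Relation.Unary.All.Properties as VecAllP
import Data.Vec.Relation.Unary.Unique.Propositional.Properties as VecUP

open import Defs

-- Sums and complements

-- A drawing of a switch leaves to the eye what is known about all other pairs. Here each case
-- analysis is a `Certificate`: a finite tree whose validity is a Boolean computation on facts about
-- a few named vertices, proved sound once. `Solved` fixes only the degree function and speaks of
-- all its realizations, so nothing has to decrease along a switch. A certificate may end in any
-- pattern solved earlier, and the order of the patterns is the whole induction. What certificates
-- cannot see is the rest of the graph. A vertex whose degree exceeds the number of its known
-- neighbours supplies another one, which becomes a named vertex. When no outer vertex or edge leads
-- any further, all adjacencies are known and the degrees can be compared with the excluded
-- sequences. For `K₂,₄` and `book` the number of pages and leaves stays open, which is why these
-- two end in a count and the two cycle patterns in a fixed sequence.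

∑ : ∀ {A : Set} → (A → ℕ) → List A → ℕ
∑ f xs = sum (map f xs)

∑-cong : ∀ {A : Set} {f g : A → ℕ} → f ≗ g → ∀ xs → ∑ f xs ≡ ∑ g xs
∑-cong f≗g xs = cong sum (map-cong f≗g xs)

∑-++ : ∀ {A : Set} (f : A → ℕ) xs {ys} → ∑ f (xs ++ ys) ≡ ∑ f xs + ∑ f ys
∑-++ f xs {ys} = trans (cong sum (map-++ f xs ys)) (sum-++ (map f xs) (map f ys))

∑-↭ : ∀ {A : Set} (f : A → ℕ) {xs ys} → xs ↭ ys → ∑ f xs ≡ ∑ f ys
∑-↭ f xs↭ys = sum-↭ (Perm.map⁺ f xs↭ys)

∑-+ : ∀ {A : Set} (f g : A → ℕ) xs → ∑ (λ x → f x + g x) xs ≡ ∑ f xs + ∑ g xs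
∑-+ f g []       = refl
∑-+ f g (x ∷ xs) = trans (cong (f x + g x +_) (∑-+ f g xs)) (interchange (f x) (g x) (∑ f xs) (∑ g xs))
  where
  interchange : ∀ a b c d → (a + b) + (c + d) ≡ (a + c) + (b + d)
  interchange = solve-∀

∑-* : ∀ {A : Set} c (f : A → ℕ) xs → ∑ (λ x → c * f x) xs ≡ c * ∑ f xs
∑-* c f []       = sym (*-zeroʳ c)
∑-* c f (x ∷ xs) = trans (cong (c * f x +_) (∑-* c f xs)) (sym (*-distribˡ-+ c (f x) (∑ f xs)))

∑-const : ∀ {A : Set} {f : A → ℕ} {c xs} → All (λ x → f x ≡ c) xs → ∑ f xs ≡ length xs * c
∑-const []         = refl
∑-const (eq ∷ eqs) = cong₂ _+_ eq (∑-const eqs)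

∑-mono : ∀ {A : Set} {f g : A → ℕ} → (∀ x → f x ≤ g x) → ∀ xs → ∑ f xs ≤ ∑ g xs
∑-mono f≤g []       = z≤n
∑-mono f≤g (x ∷ xs) = +-mono-≤ (f≤g x) (∑-mono f≤g xs)

∑-zero : ∀ {A : Set} {f : A → ℕ} {xs} → All (λ x → f x ≡ 0) xs → ∑ f xs ≡ 0
∑-zero {xs = xs} zs = trans (∑-const zs) (*-zeroʳ (length xs))

-- Induction on `xs`: `shift` moves its head to the front of `ys`, and the later members remain in
-- the rest because they differ from the head.
extract : ∀ {A : Set} {xs ys : List A} → Unique xs → xs ⊆ ys → ∃ λ rs → ys ↭ xs ++ rs
extract []            _     = _ , ↭-refl
extract {xs = x ∷ xs} u@(_ ∷ uxs) xs⊆ys with ∈-∃++ (xs⊆ys (here refl))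
... | ps , qs , refl =
  let rs , ps++qs↭ = extract uxs λ y∈xs → drop-head (λ { refl → Unique[x∷xs]⇒x∉xs u y∈xs })
                                            (Perm.∈-resp-↭ (Perm.shift x ps qs) (xs⊆ys (there y∈xs)))
  in  rs , ↭-trans (Perm.shift x ps qs) (prep x ps++qs↭)
  where
  drop-head : ∀ {y zs} → y ≢ x → y ∈ x ∷ zs → y ∈ zs
  drop-head y≢x (here y≡x)   = contradiction y≡x y≢x
  drop-head _   (there y∈zs) = y∈zs

unique-length : ∀ {A : Set} {xs ys : List A} → Unique xs → xs ⊆ ys → length xs ≤ length ys
unique-length {xs = xs} uxs xs⊆ys =
  let rs , ys↭ = extract uxs xs⊆ys
  in  subst (length xs ≤_) (sym (trans (Perm.↭-length ys↭) (length-++ xs))) (m≤m+n _ _)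

++-disjoint : ∀ {A : Set} (xs : List A) {ys} → Unique (xs ++ ys) → All (_∉ xs) ys
++-disjoint []       _          = All.universal (λ _ ()) _
++-disjoint (x ∷ xs) (px ∷ uxs) =
  All.zipWith (λ { (x≢y , y∉xs) (here refl) → x≢y refl ; (x≢y , y∉xs) (there y∈xs) → y∉xs y∈xs })
              (++⁻ʳ xs px , ++-disjoint xs uxs)

complement : ∀ {n} {xs : List (Fin n)} → Unique xs → ∃ λ rs → allFin n ↭ xs ++ rs × All (_∉ xs) rs
complement {n} {xs} uxs =
  let rs , p = extract uxs (λ _ → ∈-allFin _)
  in  rs , p , ++-disjoint xs (PermSetoid.Unique-resp-↭ (setoid _) (↭⇒↭ₛ p) (allFin⁺ n))

complement-length : ∀ {n} {xs rs : List (Fin n)} → allFin n ↭ xs ++ rs → n ≡ length xs + length rs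
complement-length {n} {xs} p = trans (sym (length-tabulate id)) (trans (Perm.↭-length p) (length-++ xs))

∑-complement : ∀ {n} (f : Fin n → ℕ) xs {rs} → allFin n ↭ xs ++ rs → ∑ f (allFin n) ≡ ∑ f xs + ∑ f rs
∑-complement f xs p = trans (∑-↭ f p) (∑-++ f xs)

-- In the uses below `A` is `Good d`, which lies in `Set₁`; hence the free level. Either one vertex
-- already yields a butterfly, or all vertices share the structural property.
traverse : ∀ {a} {A : Set a} {B : Set} {P : B → Set} →
           {xs : List B} → All (λ x → A ⊎ P x) xs → A ⊎ All P xs
traverse []              = inj₂ []
traverse (inj₁ a  ∷ _)   = inj₁ a
traverse (inj₂ px ∷ pxs) with traverse pxs
... | inj₁ a   = inj₁ a
... | inj₂ pxs = inj₂ (px ∷ pxs)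

-- Degrees

bit : Bool → ℕ
bit b = if b then 1 else 0

bit≤1 : ∀ b → bit b ≤ 1
bit≤1 false = z≤n
bit≤1 true  = ≤-refl

row : ∀ {n} → Graph n → Fin n → Fin n → ℕ
row G u v = bit (does (adj? G u v))

module _ {n} (G : Graph n) where

  row-adj : ∀ {u v} → Adj G u v → row G u v ≡ 1
  row-adj uv = cong bit (dec-true (adj? G _ _) uv)

  row-nonadj : ∀ {u v} → ¬ Adj G u v → row G u v ≡ 0
  row-nonadj ¬uv = cong bit (dec-false (adj? G _ _) ¬uv)

  row-self : ∀ v → row G v v ≡ 0
  row-self v = row-nonadj (adj-irrefl G refl)

  row-sym : ∀ u v → row G u v ≡ row G v u
  row-sym u v with adj? G u v
  ... | yes uv = sym (row-adj (adj-sym G uv))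
  ... | no ¬uv = sym (row-nonadj (¬uv ∘ adj-sym G))

  degree-∑ : ∀ v → degree G v ≡ ∑ (row G v) (allFin n)
  degree-∑ v = go id
    where
    go : ∀ {m} (f : Fin m → Fin n) → Vec.count (adj? G v) (Vec.tabulate f) ≡ ∑ (row G v) (List.tabulate f)
    go {zero}  f = refl
    go {suc m} f with does (adj? G v (f zero))
    ... | true  = cong suc (go (f ∘ suc))
    ... | false = go (f ∘ suc)

  degree-split : ∀ v xs {rs} → allFin n ↭ xs ++ rs → degree G v ≡ ∑ (row G v) xs + ∑ (row G v) rs
  degree-split v xs p = trans (degree-∑ v) (∑-complement (row G v) xs p)

  neighbours≤degree : ∀ {v xs} → Unique xs → All (Adj G v) xs → length xs ≤ degree G v
  neighbours≤degree {v} {xs} uxs adj =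
    let rs , p , _ = complement uxs
    in  subst (length xs ≤_)
          (sym (trans (degree-split v xs p)
                      (cong (_+ ∑ (row G v) rs) (trans (∑-const (All.map row-adj adj)) (*-identityʳ _)))))
          (m≤m+n _ _)

  ∑-row≤length : ∀ v xs → ∑ (row G v) xs ≤ length xs
  ∑-row≤length v xs = ≤-trans (∑-mono (λ _ → bit≤1 _) xs)
    (≤-reflexive (trans (∑-const {f = λ _ → 1} (All.universal (λ _ → refl) xs)) (*-identityʳ _)))

  nonneighbours+degree≤n : ∀ {v xs} → Unique xs → All (¬_ ∘ Adj G v) xs → length xs + degree G v ≤ n
  nonneighbours+degree≤n {v} {xs} uxs nonadj =
    let rs , p , _ = complement uxs
        deg≤ : degree G v ≤ length rs
        deg≤ = subst (_≤ length rs)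
                 (sym (trans (degree-split v xs p)
                             (cong (_+ ∑ (row G v) rs) (∑-zero (All.map row-nonadj nonadj)))))
                 (∑-row≤length v rs)
    in  subst (length xs + degree G v ≤_) (sym (complement-length {xs = xs} p)) (+-monoʳ-≤ (length xs) deg≤)

  -- If every vertex outside `xs` were nonadjacent to `v`, its row would vanish there and the degree
  -- would be at most `length xs`.
  further-neighbour : ∀ {v xs} → Unique xs → length xs < degree G v → ∃ λ u → Adj G v u × u ∉ xs
  further-neighbour {v} {xs} uxs len<deg with complement uxs
  ... | rs , p , rs∉xs with any? (adj? G v) rs
  ... | yes found = let u , u∈rs , vu = find found in u , vu , All.lookup rs∉xs u∈rs
  ... | no none = contradiction len<deg (≤⇒≯ (subst (_≤ length xs)
      (sym (trans (degree-split v xs p)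
           (trans (cong (∑ (row G v) xs +_) (∑-zero (All.map row-nonadj (AllP.¬Any⇒All¬ rs none)))) (+-identityʳ _))))
      (∑-row≤length v xs)))

-- Changing one pair of a graph

Pair : ∀ {n} → Fin n → Fin n → Fin n → Fin n → Set
Pair a b x y = (a ≡ x × b ≡ y) ⊎ (a ≡ y × b ≡ x)

pair? : ∀ {n} (a b x y : Fin n) → Dec (Pair a b x y)
pair? a b x y = (a ≟ x ×-dec b ≟ y) ⊎-dec (a ≟ y ×-dec b ≟ x)

pair-sym : ∀ {n} {a b x y : Fin n} → Pair a b x y → Pair a b y x
pair-sym (inj₁ p) = inj₂ p
pair-sym (inj₂ p) = inj₁ p

module _ {n} (G : Graph n) (a b : Fin n) (β : Bool) (a≢b : a ≢ b) where

  -- One construction both deletes (`false`) and inserts (`true`) an edge, so that a switch is four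
  -- instances of it and one degree formula covers all four.
  data Assigned (x y : Fin n) : Set where
    here  : Pair a b x y → T β → Assigned x y
    there : ¬ Pair a b x y → Adj G x y → Assigned x y

  assign : Graph n
  assign = record
    { Adj        = Assigned
    ; adj?       = dec
    ; adj-sym    = λ { (here p t) → here (pair-sym p) t ; (there ¬p xy) → there (¬p ∘ pair-sym) (adj-sym G xy) }
    ; adj-irrefl = λ { refl (here (inj₁ (refl , refl)) _) → a≢b refl
                     ; refl (here (inj₂ (refl , refl)) _) → a≢b refl
                     ; x≡y (there _ xy) → adj-irrefl G x≡y xy }
    }
    where
    dec : ∀ x y → Dec (Assigned x y)
    dec x y with pair? a b x y | T? β | adj? G x y
    ... | yes p | yes t | _      = yes (here p t)
    ... | yes p | no ¬t | _      = no λ { (here _ t) → ¬t t ; (there ¬p _) → ¬p p }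
    ... | no ¬p | _     | yes xy = yes (there ¬p xy)
    ... | no ¬p | _     | no ¬xy = no λ { (here p _) → ¬p p ; (there _ xy) → ¬xy xy }

  endpoints : Fin n → ℕ
  endpoints x = bit (does (a ≟ x)) + bit (does (b ≟ x))

  ∑-≟ : ∀ c → ∑ (λ y → bit (does (c ≟ y))) (allFin n) ≡ 1
  ∑-≟ c = let rs , p , rs∉ = complement {xs = c ∷ []} ([] ∷ [])
          in  trans (∑-complement _ (c ∷ []) p)
                (cong₂ _+_ (cong (λ b → bit b + 0) (dec-true (c ≟ c) refl))
                  (∑-zero (All.map (λ y∉ → cong bit (dec-false (c ≟ _) (λ c≡y → y∉ (here (sym c≡y))))) rs∉)))

  row-assign : ∀ x y → row assign x y + row G a b * bit (does (pair? a b x y))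
                     ≡ row G x y + bit β * bit (does (pair? a b x y))
  row-assign x y = go (pair? a b x y)
    where
    go : (p? : Dec (Pair a b x y)) →
         row assign x y + row G a b * bit (does p?) ≡ row G x y + bit β * bit (does p?)
    go (no ¬p) = cong₂ _+_ same (trans (*-zeroʳ (row G a b)) (sym (*-zeroʳ (bit β))))
      where
      same : row assign x y ≡ row G x y
      same = cong bit (does-⇔ (mk⇔ (λ { (here p _) → contradiction p ¬p ; (there _ xy) → xy }) (there ¬p))
                              (adj? assign x y) (adj? G x y))
    go (yes p) = trans (cong₂ _+_ new (trans (*-identityʳ _) (old p)))
                   (trans (+-comm (bit β) (row G x y)) (cong (row G x y +_) (sym (*-identityʳ _))))
      where
      new : row assign x y ≡ bit β
      new = cong bit (does-⇔ (mk⇔ (λ { (here _ t) → t ; (there ¬p _) → contradiction p ¬p }) (here p))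
                             (adj? assign x y) (T? β))
      old : Pair a b x y → row G a b ≡ row G x y
      old (inj₁ (refl , refl)) = refl
      old (inj₂ (refl , refl)) = row-sym G a b

  -- The two orientations exclude each other because `a ≢ b`. The indicator of their disjunction is
  -- therefore a sum of products, over which `∑` distributes.
  pair-count : ∀ x y → bit (does (pair? a b x y))
                     ≡ bit (does (a ≟ x)) * bit (does (b ≟ y)) + bit (does (b ≟ x)) * bit (does (a ≟ y))
  pair-count x y with a ≟ x | b ≟ x | b ≟ y | a ≟ y
  ... | yes refl | yes refl | _     | _     = contradiction refl a≢b
  ... | yes _    | no _     | yes _ | _     = refl
  ... | yes _    | no _     | no _  | yes _ = refl
  ... | yes _    | no _     | no _  | no _  = refl
  ... | no _     | yes _    | _     | yes _ = refl
  ... | no _     | yes _    | _     | no _  = refl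
  ... | no _     | no _     | _     | yes _ = refl
  ... | no _     | no _     | _     | no _  = refl

  ∑-pair : ∀ x → ∑ (λ y → bit (does (pair? a b x y))) (allFin n) ≡ endpoints x
  ∑-pair x = begin
    ∑ (λ y → bit (does (pair? a b x y))) (allFin n)       ≡⟨ ∑-cong (pair-count x) (allFin n) ⟩
    ∑ (λ y → ax * B y + bx * A y) (allFin n)              ≡⟨ ∑-+ _ _ (allFin n) ⟩
    ∑ (λ y → ax * B y) (allFin n) + ∑ (λ y → bx * A y) (allFin n)
      ≡⟨ cong₂ _+_ (trans (∑-* ax B (allFin n)) (cong (ax *_) (∑-≟ b)))
                   (trans (∑-* bx A (allFin n)) (cong (bx *_) (∑-≟ a))) ⟩
    ax * 1 + bx * 1                                       ≡⟨ cong₂ _+_ (*-identityʳ ax) (*-identityʳ bx) ⟩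
    endpoints x                                           ∎
    where
    open ≡-Reasoning
    ax bx : ℕ
    ax = bit (does (a ≟ x))
    bx = bit (does (b ≟ x))
    A B : Fin n → ℕ
    A y = bit (does (a ≟ y))
    B y = bit (does (b ≟ y))

  -- Both sides carry a product so that no case distinction on the old and new
  -- status of the pair is needed.
  degree-assign : ∀ x → degree assign x + row G a b * endpoints x ≡ degree G x + bit β * endpoints x
  degree-assign x = begin
    degree assign x + row G a b * endpoints x     ≡⟨ cong₂ _+_ (degree-∑ assign x) (expand (row G a b)) ⟩
    ∑ (row assign x) (allFin n) + ∑ (λ y → row G a b * P y) (allFin n)
                                                  ≡⟨ ∑-+ _ _ (allFin n) ⟨
    ∑ (λ y → row assign x y + row G a b * P y) (allFin n)
                                                  ≡⟨ ∑-cong (row-assign x) (allFin n) ⟩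
    ∑ (λ y → row G x y + bit β * P y) (allFin n)  ≡⟨ ∑-+ _ _ (allFin n) ⟩
    ∑ (row G x) (allFin n) + ∑ (λ y → bit β * P y) (allFin n)
                                                  ≡⟨ cong₂ _+_ (degree-∑ G x) (expand (bit β)) ⟨
    degree G x + bit β * endpoints x              ∎
    where
    open ≡-Reasoning
    P : Fin n → ℕ
    P y = bit (does (pair? a b x y))
    expand : ∀ c → c * endpoints x ≡ ∑ (λ y → c * P y) (allFin n)
    expand c = trans (cong (c *_) (sym (∑-pair x))) (sym (∑-* c P (allFin n)))

-- Certificates

-- Fact k speaks about k distinct vertices of an otherwise unknown graph; heavy
-- stands for degree at least two, which no switch changes.

infix 6 _~_ _≁_

data Fact (k : ℕ) : Set where
  _~_ _≁_ : Fin k → Fin k → Fact k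
  heavy   : Fin k → Fact k

record Pattern : Set where
  constructor pattern-of
  field
    order : ℕ
    facts : List (Fact order)

open Pattern

rename : ∀ {m k} → (Fin m → Fin k) → Fact m → Fact k
rename f (i ~ j)   = f i ~ f j
rename f (i ≁ j)   = f i ≁ f j
rename f (heavy i) = heavy (f i)

implies : ∀ {k} → Fact k → Fact k → Bool
implies (i ~ j)   (k ~ l)   = ⌊ pair? i j k l ⌋
implies (i ≁ j)   (k ≁ l)   = ⌊ pair? i j k l ⌋
implies (heavy i) (heavy j) = ⌊ i ≟ j ⌋
implies _         _         = false

known : ∀ {k} → List (Fact k) → Fact k → Bool
known Φ φ = any (λ ψ → implies ψ φ) Φ

-- Changing the pair `ij` can falsify only facts about this very pair.
independent : ∀ {k} → Fin k → Fin k → Fact k → Bool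
independent i j (k ~ l)   = not ⌊ pair? i j k l ⌋
independent i j (k ≁ l)   = not ⌊ pair? i j k l ⌋
independent i j (heavy _) = true

join cut : ∀ {k} → Fin k → Fin k → List (Fact k) → List (Fact k)
join i j Φ = i ~ j ∷ filterᵇ (independent i j) Φ
cut  i j Φ = i ≁ j ∷ filterᵇ (independent i j) Φ

-- A certificate derives, from facts about a graph, that some graph with the
-- same degrees contains one of the target patterns.  A switch replaces the
-- edges ij and kl by ik and jl.

data Certificate (targets : List Pattern) (k : ℕ) : Set where
  reach  : ∀ {P} → P ∈ targets → Vec (Fin k) (order P) → Certificate targets k
  query  : Fin k → Fin k → Certificate targets k → Certificate targets k → Certificate targets k
  switch : Fin k → Fin k → Fin k → Fin k → Certificate targets k → Certificate targets k

unique? : ∀ {k m} (is : Vec (Fin k) m) → Dec (Uniqueᵛ is)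
unique? = VecAllPairs.allPairs? (λ i j → ¬? (i ≟ j))

-- The four lookups happen along the way, so that they also see that the two
-- edges differ.
switchable : ∀ {k} → List (Fact k) → (i j l m : Fin k) → Bool
switchable Φ i j k l =
    not ⌊ i ≟ k ⌋ ∧ not ⌊ j ≟ l ⌋
  ∧ known Φ (i ~ j) ∧ known (cut i j Φ) (k ~ l)
  ∧ known (cut k l (cut i j Φ)) (i ≁ k) ∧ known (join i k (cut k l (cut i j Φ))) (j ≁ l)

switched : ∀ {k} → List (Fact k) → (i j l m : Fin k) → List (Fact k)
switched Φ i j k l = join j l (join i k (cut k l (cut i j Φ)))

-- No graph occurs: the facts are updated along the tree, so a concrete certificate is checked by
-- evaluation.
valid : ∀ {Ps k} → List (Fact k) → Certificate Ps k → Bool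
valid Φ (reach {P} _ is)     = ⌊ unique? is ⌋ ∧ all (known Φ ∘ rename (lookup is)) (facts P)
valid Φ (query i j c d)      = valid (i ~ j ∷ Φ) c ∧ valid (i ≁ j ∷ Φ) d
valid Φ (switch i j k l c)   = switchable Φ i j k l ∧ valid (switched Φ i j k l) c

∧-split : ∀ {x y} → T (x ∧ y) → T x × T y
∧-split = Equivalence.to T-∧

module _ {n} (d : Fin n → ℕ) where

  record Good : Set₁ where
    constructor realized
    field
      graph    : Graph n
      degrees  : degree graph ≗ d
      contains : K₅-C₄ ⊑ graph

  -- `heavy` refers to the prescribed `d` and not to `degree G`: between the four assignments of a
  -- switch the graph does not have the degrees `d`.
  Holds : ∀ {k} → Graph n → Vec (Fin n) k → Fact k → Set
  Holds G vs (i ~ j)   = Adj G (lookup vs i) (lookup vs j)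
  Holds G vs (i ≁ j)   = ¬ Adj G (lookup vs i) (lookup vs j)
  Holds G vs (heavy i) = 2 ≤ d (lookup vs i)

  Solved : Pattern → Set₁
  Solved P = ∀ G → degree G ≗ d → ∀ vs → Uniqueᵛ vs → All (Holds G vs) (facts P) → Good

  module _ {k} {vs : Vec (Fin n) k} where

    pair-lookup : ∀ {i j x y : Fin k} → Pair i j x y → Pair (lookup vs i) (lookup vs j) (lookup vs x) (lookup vs y)
    pair-lookup (inj₁ (refl , refl)) = inj₁ (refl , refl)
    pair-lookup (inj₂ (refl , refl)) = inj₂ (refl , refl)

    implies-sound : ∀ {G} φ ψ → T (implies φ ψ) → Holds G vs φ → Holds G vs ψ
    implies-sound {G} (i ~ j) (x ~ y) t h with toWitness {a? = pair? i j x y} t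
    ... | inj₁ (refl , refl) = h
    ... | inj₂ (refl , refl) = adj-sym G h
    implies-sound {G} (i ≁ j) (x ≁ y) t h with toWitness {a? = pair? i j x y} t
    ... | inj₁ (refl , refl) = h
    ... | inj₂ (refl , refl) = h ∘ adj-sym G
    implies-sound (heavy i) (heavy j) t h with refl ← toWitness {a? = i ≟ j} t = h

    known-sound : ∀ {G} {Φ φ} → T (known Φ φ) → All (Holds G vs) Φ → Holds G vs φ
    known-sound {G} {Φ} {φ} t hs =
      let ψ , ψ∈Φ , tψ = find (any⁻ (λ ψ → implies ψ φ) Φ t)
      in  implies-sound ψ φ tψ (All.lookup hs ψ∈Φ)

    module _ (uvs : Uniqueᵛ vs) (G : Graph n) where

      pair-lookup⁻ : ∀ {i j x y} → Pair (lookup vs i) (lookup vs j) (lookup vs x) (lookup vs y) → Pair i j x y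
      pair-lookup⁻ (inj₁ (p , q)) = inj₁ (lookup-injective uvs _ _ p , lookup-injective uvs _ _ q)
      pair-lookup⁻ (inj₂ (p , q)) = inj₂ (lookup-injective uvs _ _ p , lookup-injective uvs _ _ q)

      module _ {i j} (β : Bool) (i≢j : lookup vs i ≢ lookup vs j) where

        assign-keeps : ∀ φ → T (independent i j φ) → Holds G vs φ → Holds (assign G _ _ β i≢j) vs φ
        assign-keeps (x ~ y)   t h = there (toWitnessFalse {a? = pair? i j x y} t ∘ pair-lookup⁻) h
        assign-keeps (x ≁ y)   t h (here p _)   = toWitnessFalse {a? = pair? i j x y} t (pair-lookup⁻ p)
        assign-keeps (x ≁ y)   t h (there _ xy) = h xy
        assign-keeps (heavy _) t h = h

        assign-filter : ∀ {Φ} → All (Holds G vs) Φ →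
                        All (Holds (assign G _ _ β i≢j) vs) (filterᵇ (independent i j) Φ)
        assign-filter {Φ} hs = All.zipWith (λ {φ} (t , h) → assign-keeps φ t h)
          (AllP.all-filter (T? ∘ independent i j) Φ , AllP.filter⁺ (T? ∘ independent i j) hs)

      cut-sound : ∀ {i j} (i≢j : lookup vs i ≢ lookup vs j) {Φ} → All (Holds G vs) Φ →
                  All (Holds (assign G _ _ false i≢j) vs) (cut i j Φ)
      cut-sound i≢j hs = (λ { (there ¬p _) → ¬p (inj₁ (refl , refl)) }) ∷ assign-filter false i≢j hs

      join-sound : ∀ {i j} (i≢j : lookup vs i ≢ lookup vs j) {Φ} → All (Holds G vs) Φ →
                   All (Holds (assign G _ _ true i≢j) vs) (join i j Φ)
      join-sound i≢j hs = here (inj₁ (refl , refl)) _ ∷ assign-filter true i≢j hs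

  -- Here `i` to `l` are indicators, at one fixed vertex, of being the respective endpoint. The two
  -- deletions and the two insertions each amount to `i + j + k + l`.
  switch-degree : ∀ i j k l {d₀ d₁ d₂ d₃ d₄ r₁ r₂ r₃ r₄} →
    d₁ + r₁ * (i + j) ≡ d₀ + 0 * (i + j) → r₁ ≡ 1 →
    d₂ + r₂ * (k + l) ≡ d₁ + 0 * (k + l) → r₂ ≡ 1 →
    d₃ + r₃ * (i + k) ≡ d₂ + 1 * (i + k) → r₃ ≡ 0 →
    d₄ + r₄ * (j + l) ≡ d₃ + 1 * (j + l) → r₄ ≡ 0 → d₄ ≡ d₀
  switch-degree i j k l {d₀} {d₁} {d₂} {d₃} {d₄} e₁ refl e₂ refl e₃ refl e₄ refl = begin
    d₄                              ≡⟨ trans (sym (+-identityʳ d₄)) e₄ ⟩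
    d₃ + 1 * (j + l)                ≡⟨ cong (_+ 1 * (j + l)) (trans (sym (+-identityʳ d₃)) e₃) ⟩
    d₂ + 1 * (i + k) + 1 * (j + l)  ≡⟨ rearrange d₂ i j k l ⟩
    d₂ + 1 * (k + l) + 1 * (i + j)  ≡⟨ cong (_+ 1 * (i + j)) (trans e₂ (+-identityʳ d₁)) ⟩
    d₁ + 1 * (i + j)                ≡⟨ trans e₁ (+-identityʳ d₀) ⟩
    d₀                              ∎
    where
    open ≡-Reasoning
    rearrange : ∀ c i j k l → c + 1 * (i + k) + 1 * (j + l) ≡ c + 1 * (k + l) + 1 * (i + j)
    rearrange = solve-∀

  -- `holds` concerns only the vertices named in `vs`; `keeps` covers edges to any other vertex and
  -- lets `gather` retain the neighbours already collected.
  record Switched {k} (vs : Vec (Fin n) k) (G : Graph n) (Φ : List (Fact k)) (i j l m : Fin k) : Set₁ where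
    field
      graph   : Graph n
      degrees : degree graph ≗ degree G
      holds   : All (Holds graph vs) (switched Φ i j l m)
      keeps   : ∀ {x y} → ¬ Pair (lookup vs i) (lookup vs j) x y → ¬ Pair (lookup vs l) (lookup vs m) x y →
                Adj G x y → Adj graph x y

  assign-true-keeps : ∀ {G : Graph n} {a b} (a≢b : a ≢ b) {x y} → Adj G x y → Adj (assign G a b true a≢b) x y
  assign-true-keeps {a = a} {b} _ {x} {y} xy with pair? a b x y
  ... | yes p = here p _
  ... | no ¬p = there ¬p xy

  switch-graph : ∀ {k} {vs : Vec (Fin n) k} → Uniqueᵛ vs → ∀ G Φ i j k l → T (switchable Φ i j k l) →
                 All (Holds G vs) Φ → Switched vs G Φ i j k l
  switch-graph {vs = vs} uvs G Φ i j k l t hs =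
    let Φ₁ = cut i j Φ
        Φ₂ = cut k l Φ₁
        Φ₃ = join i k Φ₂
        ti , t  = ∧-split {not ⌊ i ≟ k ⌋} t
        tj , t  = ∧-split {not ⌊ j ≟ l ⌋} t
        t₀ , t  = ∧-split {known Φ (i ~ j)} t
        t₁ , t  = ∧-split {known Φ₁ (k ~ l)} t
        t₂ , t₃ = ∧-split {known Φ₂ (i ≁ k)} t
        e₀  = known-sound {φ = i ~ j} t₀ hs
        i≢j = λ eq → adj-irrefl G eq e₀
        i≢k = λ eq → toWitnessFalse {a? = i ≟ k} ti (lookup-injective uvs _ _ eq)
        j≢l = λ eq → toWitnessFalse {a? = j ≟ l} tj (lookup-injective uvs _ _ eq)
        G₁  = assign G _ _ false i≢j
        h₁  = cut-sound uvs G i≢j hs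
        e₁  = known-sound {φ = k ~ l} t₁ h₁
        k≢l = λ eq → adj-irrefl G₁ eq e₁
        G₂  = assign G₁ _ _ false k≢l
        h₂  = cut-sound uvs G₁ k≢l h₁
        e₂  = known-sound {φ = i ≁ k} t₂ h₂
        G₃  = assign G₂ _ _ true i≢k
        h₃  = join-sound uvs G₂ i≢k h₂
        e₃  = known-sound {φ = j ≁ l} t₃ h₃
    in  record
      { graph   = assign G₃ _ _ true j≢l
      ; degrees = λ x → switch-degree (at x i) (at x j) (at x k) (at x l)
          (degree-assign G _ _ false i≢j x)  (row-adj G e₀)
          (degree-assign G₁ _ _ false k≢l x) (row-adj G₁ e₁)
          (degree-assign G₂ _ _ true i≢k x)  (row-nonadj G₂ e₂)
          (degree-assign G₃ _ _ true j≢l x)  (row-nonadj G₃ e₃)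
      ; holds   = join-sound uvs G₃ j≢l h₃
      ; keeps   = λ ¬ij ¬kl xy → assign-true-keeps j≢l (assign-true-keeps i≢k (there ¬kl (there ¬ij xy)))
      }
    where
    at : Fin n → Fin _ → ℕ
    at x m = bit (does (lookup vs m ≟ x))

  module _ {Ps} (solved : ∀ {P} → P ∈ Ps → Solved P) where

    -- The induction is on the certificate with the graph varying: a `query` decides an adjacency,
    -- while a `switch` continues in another realization of `d`.
    sound : ∀ {k} {vs : Vec (Fin n) k} → Uniqueᵛ vs → ∀ G → degree G ≗ d →
            ∀ {Φ} (c : Certificate Ps k) → T (valid Φ c) → All (Holds G vs) Φ → Good
    sound {k} {vs} uvs G deg {Φ} (reach {P} P∈Ps is) t hs =
      let tu , ta = ∧-split t
          uis = toWitness {a? = unique? is} tu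
      in  solved P∈Ps G deg (Vec.map (lookup vs) is)
            (VecUP.map⁺ (λ {x} {y} → lookup-injective uvs x y) uis)
            (All.map (λ {φ} tφ → renamed φ (known-sound tφ hs)) (all⁺ (known Φ ∘ rename (lookup is)) (facts P) ta))
      where
      renamed : ∀ φ → Holds G vs (rename (lookup is) φ) → Holds G (Vec.map (lookup vs) is) φ
      renamed (i ~ j)   h rewrite lookup-map i (lookup vs) is | lookup-map j (lookup vs) is = h
      renamed (i ≁ j)   h rewrite lookup-map i (lookup vs) is | lookup-map j (lookup vs) is = h
      renamed (heavy i) h rewrite lookup-map i (lookup vs) is = h
    sound {vs = vs} uvs G deg (query i j c e) t hs with adj? G (lookup vs i) (lookup vs j)
    ... | yes ij = sound uvs G deg c (proj₁ (∧-split t)) (ij ∷ hs)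
    ... | no ¬ij = sound uvs G deg e (proj₂ (∧-split t)) (¬ij ∷ hs)
    sound {vs = vs} uvs G deg {Φ} (switch i j k l c) t hs =
      let ts , tc = ∧-split {switchable Φ i j k l} t
          open Switched (switch-graph uvs G Φ i j k l ts hs)
      in  sound uvs graph (λ x → trans (degrees x) (deg x)) c tc holds

-- Patterns

-- In each pattern but K₂,₄ and book, vertex 0 is the common neighbour of 1 to 4;
-- these two list their two spine vertices first.  C₃·C₄ and C₃·C₅ are a triangle
-- and a cycle sharing vertex 0.

butterfly K₂,₄ book C₃·C₄ C₃·C₅ tailed path loose edge independent₄ star₄ : Pattern

butterfly = pattern-of 5
  (0F ~ 1F ∷ 0F ~ 2F ∷ 0F ~ 3F ∷ 0F ~ 4F ∷ 1F ~ 2F ∷ 3F ~ 4F ∷ [])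

K₂,₄ = pattern-of 6
  ( 0F ~ 2F ∷ 0F ~ 3F ∷ 0F ~ 4F ∷ 0F ~ 5F ∷ 1F ~ 2F ∷ 1F ~ 3F ∷ 1F ~ 4F ∷ 1F ~ 5F
  ∷ 0F ≁ 1F ∷ 2F ≁ 3F ∷ 2F ≁ 4F ∷ 2F ≁ 5F ∷ 3F ≁ 4F ∷ 3F ≁ 5F ∷ 4F ≁ 5F ∷ [])

book = pattern-of 5
  ( 0F ~ 1F ∷ 0F ~ 2F ∷ 0F ~ 3F ∷ 0F ~ 4F ∷ 1F ~ 2F ∷ 1F ~ 3F ∷ 1F ~ 4F
  ∷ 2F ≁ 3F ∷ 2F ≁ 4F ∷ 3F ≁ 4F ∷ [])

C₃·C₄ = pattern-of 6
  ( 0F ~ 1F ∷ 0F ~ 2F ∷ 0F ~ 3F ∷ 0F ~ 4F ∷ 1F ~ 2F ∷ 3F ~ 5F ∷ 4F ~ 5F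
  ∷ 0F ≁ 5F ∷ 1F ≁ 3F ∷ 1F ≁ 4F ∷ 1F ≁ 5F ∷ 2F ≁ 3F ∷ 2F ≁ 4F ∷ 2F ≁ 5F ∷ 3F ≁ 4F ∷ [])

C₃·C₅ = pattern-of 7
  ( 0F ~ 1F ∷ 0F ~ 2F ∷ 0F ~ 3F ∷ 0F ~ 4F ∷ 1F ~ 2F ∷ 3F ~ 5F ∷ 4F ~ 6F ∷ 5F ~ 6F
  ∷ 0F ≁ 5F ∷ 0F ≁ 6F ∷ 1F ≁ 3F ∷ 1F ≁ 4F ∷ 1F ≁ 5F ∷ 1F ≁ 6F ∷ 2F ≁ 3F ∷ 2F ≁ 4F
  ∷ 2F ≁ 5F ∷ 2F ≁ 6F ∷ 3F ≁ 4F ∷ 3F ≁ 6F ∷ 4F ≁ 5F ∷ [])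

-- From here on the patterns record what is known among four neighbours of the centre: `path` two
-- edges with a common end, `edge` one edge, `star₄` none. In `tailed`, `loose` and `independent₄`
-- recorded nonedges force the second neighbour of a heavy vertex to lie outside.
tailed = pattern-of 5
  ( 0F ~ 1F ∷ 0F ~ 2F ∷ 0F ~ 3F ∷ 0F ~ 4F ∷ 1F ~ 2F ∷ 1F ~ 3F
  ∷ 1F ≁ 4F ∷ 2F ≁ 4F ∷ 3F ≁ 4F ∷ heavy 4F ∷ [])

path = pattern-of 5
  (0F ~ 1F ∷ 0F ~ 2F ∷ 0F ~ 3F ∷ 0F ~ 4F ∷ 1F ~ 2F ∷ 1F ~ 3F ∷ heavy 4F ∷ [])

loose = pattern-of 5
  ( 0F ~ 1F ∷ 0F ~ 2F ∷ 0F ~ 3F ∷ 0F ~ 4F ∷ 1F ~ 2F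
  ∷ 1F ≁ 3F ∷ 1F ≁ 4F ∷ 2F ≁ 3F ∷ 2F ≁ 4F ∷ 3F ≁ 4F ∷ heavy 3F ∷ heavy 4F ∷ [])

edge = pattern-of 5
  (0F ~ 1F ∷ 0F ~ 2F ∷ 0F ~ 3F ∷ 0F ~ 4F ∷ 1F ~ 2F ∷ heavy 3F ∷ heavy 4F ∷ [])

independent₄ = pattern-of 5
  ( 0F ~ 1F ∷ 0F ~ 2F ∷ 0F ~ 3F ∷ 0F ~ 4F
  ∷ 1F ≁ 2F ∷ 1F ≁ 3F ∷ 1F ≁ 4F ∷ 2F ≁ 3F ∷ 2F ≁ 4F ∷ 3F ≁ 4F
  ∷ heavy 1F ∷ heavy 2F ∷ heavy 3F ∷ heavy 4F ∷ [])

star₄ = pattern-of 5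
  (0F ~ 1F ∷ 0F ~ 2F ∷ 0F ~ 3F ∷ 0F ~ 4F ∷ heavy 1F ∷ heavy 2F ∷ heavy 3F ∷ heavy 4F ∷ [])

-- New vertices are put in front of the old ones, whose indices shift.

one-more : (P : Pattern) → List (Fact (suc (order P))) → Pattern
one-more P Φ = pattern-of (suc (order P)) (Φ ++ map (rename suc) (facts P))

-- Two adjacent outer vertices: `Φ` describes `0F` and `Ψ` describes `1F`, each relative to `P`
-- alone. `punchIn 1F` makes the indices of `Φ` skip the second outer vertex.
linked : (P : Pattern) (Φ Ψ : List (Fact (suc (order P)))) → Pattern
linked P Φ Ψ = pattern-of (suc (suc (order P)))
  (0F ~ 1F ∷ map (rename (punchIn 1F)) Φ ++ map (rename suc) (facts (one-more P Ψ)))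

apart : ∀ {k} → List (Fin k) → List (Fact (suc k))
apart = map (λ i → 0F ≁ suc i)

-- Vertices outside an occurrence of a pattern

toList-unique : ∀ {A : Set} {k} {vs : Vec A k} → Uniqueᵛ vs → Unique (toList vs)
toList-unique []         = []
toList-unique (px ∷ uvs) = VecAllP.toList⁺ px ∷ toList-unique uvs

fresh⇒distinct : ∀ {A : Set} {k u} (vs : Vec A k) → u ∉ toList vs → VecAll.All (u ≢_) vs
fresh⇒distinct []       _ = []
fresh⇒distinct (x ∷ vs) u∉ = (λ u≡x → u∉ (here u≡x)) ∷ fresh⇒distinct vs (u∉ ∘ there)

lookup-or-fresh : ∀ {n k} (u : Fin n) (vs : Vec (Fin n) k) → (∃ λ i → u ≡ lookup vs i) ⊎ u ∉ toList vs
lookup-or-fresh u []       = inj₂ λ ()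
lookup-or-fresh u (x ∷ vs) with u ≟ x | lookup-or-fresh u vs
... | yes u≡x | _             = inj₁ (0F , u≡x)
... | no _    | inj₁ (i , eq) = inj₁ (suc i , eq)
... | no u≢x  | inj₂ u∉       = inj₂ λ { (here u≡x) → u≢x u≡x ; (there u∈) → u∉ u∈ }

toList-lookup : ∀ {A : Set} {k} (vs : Vec A k) → toList vs ≡ map (lookup vs) (allFin k)
toList-lookup []       = refl
toList-lookup (x ∷ vs) = cong (x ∷_) (begin
  toList vs                                      ≡⟨ toList-lookup vs ⟩
  map (lookup vs) (allFin _)                     ≡⟨ map-tabulate id (lookup vs) ⟩
  List.tabulate (lookup vs)                      ≡⟨ map-tabulate suc (lookup (x ∷ vs)) ⟨
  map (lookup (x ∷ vs)) (List.tabulate suc)      ∎)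
  where open ≡-Reasoning

settled : ∀ {k} → List (Fact k) → Fin k → Fin k → Bool
settled Φ i j = known Φ (i ~ j) ∨ known Φ (i ≁ j) ∨ ⌊ i ≟ j ⌋

pattern-degree : ∀ {k} → List (Fact k) → Fin k → ℕ
pattern-degree {k} Φ i = ∑ (λ j → bit (known Φ (i ~ j))) (allFin k)

module _ {n} (d : Fin n → ℕ) where

  rename-holds : ∀ {G k m} {vs : Vec (Fin n) k} {ws : Vec (Fin n) m} (f : Fin k → Fin m) →
                 (∀ i → lookup vs i ≡ lookup ws (f i)) →
                 ∀ {Φ} → All (Holds d G vs) Φ → All (Holds d G ws) (map (rename f) Φ)
  rename-holds {G} {vs = vs} {ws} f eq hs = AllP.map⁺ (All.map (λ {φ} → go φ) hs)
    where
    go : ∀ φ → Holds d G vs φ → Holds d G ws (rename f φ)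
    go (i ~ j)   = subst₂ (Adj G) (eq i) (eq j)
    go (i ≁ j)   = subst₂ (λ x y → ¬ Adj G x y) (eq i) (eq j)
    go (heavy i) = subst (λ x → 2 ≤ d x) (eq i)

  -- Once `valid` evaluates to `true`, the implicit argument has the unit type and is filled in by
  -- η; writing down a certificate is already proving it.
  certified : ∀ {Ps} (solved : All (Solved d) Ps) (P : Pattern) (c : Certificate Ps (order P)) →
              {T (valid (facts P) c)} → Solved d P
  certified solved P c {t} G deg vs uvs hs = sound d (All.lookup solved) uvs G deg c t hs

  butterfly-solved : Solved d butterfly
  butterfly-solved G deg vs uvs hs =
    realized G deg
      ( lookup vs ∘ place
      , (λ {i} {j} eq → place-injective i j (lookup-injective uvs _ _ eq))
      , λ {i} {j} ij → known-sound d (edges i j ij) hs)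
    where
    -- Vertex 4 of `K₅-C₄` is the centre; the diagonals 02 and 13 of the deleted cycle are the edges
    -- opposite to it in the two triangles.
    place : Fin 5 → Fin 5
    place = lookup (1F ∷ 3F ∷ 2F ∷ 4F ∷ 0F ∷ [])
    place-injective : ∀ i j → place i ≡ place j → i ≡ j
    place-injective = from-yes (all? λ i → all? λ j → (place i ≟ place j) →-dec (i ≟ j))
    edges : ∀ i j → Adj K₅-C₄ i j → T (known (facts butterfly) (place i ~ place j))
    edges = from-yes (all? λ i → all? λ j → adj? K₅-C₄ i j →-dec T? (known (facts butterfly) (place i ~ place j)))

  row-settled : ∀ {G k} {vs : Vec (Fin n) k} {Φ} i j → T (settled Φ i j) → All (Holds d G vs) Φ →
                row G (lookup vs i) (lookup vs j) ≡ bit (known Φ (i ~ j))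
  row-settled {G} {vs = vs} {Φ} i j t hs
    with known Φ (i ~ j) in eq | known Φ (i ≁ j) in eq′ | i ≟ j
  ... | true  | _     | _        = row-adj G (known-sound d {φ = i ~ j} (subst T (sym eq) _) hs)
  ... | false | true  | _        = row-nonadj G (known-sound d {φ = i ≁ j} (subst T (sym eq′) _) hs)
  ... | false | false | yes refl = row-self G (lookup vs i)

  degree-settled : ∀ {G k} {vs : Vec (Fin n) k} {Φ rs} i → allFin n ↭ toList vs ++ rs →
                   All (λ u → ¬ Adj G (lookup vs i) u) rs →
                   T (all (settled Φ i) (allFin k)) → All (Holds d G vs) Φ →
                   degree G (lookup vs i) ≡ pattern-degree Φ i
  degree-settled {G} {k} {vs} {Φ} {rs} i p none t hs = begin
    degree G x                                          ≡⟨ degree-split G x (toList vs) p ⟩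
    ∑ (row G x) (toList vs) + ∑ (row G x) rs            ≡⟨ cong₂ _+_ inner (∑-zero (All.map (row-nonadj G) none)) ⟩
    pattern-degree Φ i + 0                              ≡⟨ +-identityʳ _ ⟩
    pattern-degree Φ i                                  ∎
    where
    open ≡-Reasoning
    x : Fin n
    x = lookup vs i
    inner : ∑ (row G x) (toList vs) ≡ pattern-degree Φ i
    inner = begin
      ∑ (row G x) (toList vs)                     ≡⟨ cong (∑ (row G x)) (toList-lookup vs) ⟩
      ∑ (row G x) (map (lookup vs) (allFin k))    ≡⟨ cong sum (sym (map-∘ (allFin k))) ⟩
      ∑ (row G x ∘ lookup vs) (allFin k)
        ≡⟨ cong sum (map-cong-local (All.map (λ {j} tj → row-settled i j tj hs) (AllP.all⁺ (settled Φ i) (allFin k) t))) ⟩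
      pattern-degree Φ i                          ∎

  module _ (P : Pattern) {G : Graph n} (deg : degree G ≗ d) {vs : Vec (Fin n) (order P)} (uvs : Uniqueᵛ vs)
           (hs : All (Holds d G vs) (facts P)) where

    use-one-more : ∀ Φ → Solved d (one-more P Φ) → ∀ {u} → u ∉ toList vs → All (Holds d G (u ∷ vs)) Φ → Good d
    use-one-more Φ solved {u} u∉ hu =
      solved G deg (u ∷ vs) (fresh⇒distinct vs u∉ ∷ uvs) (++⁺ hu (rename-holds suc (λ _ → refl) hs))

    use-linked : ∀ Φ Ψ → Solved d (linked P Φ Ψ) → ∀ {u t} → Adj G u t → u ∉ toList vs → t ∉ toList vs →
                 All (Holds d G (u ∷ vs)) Φ → All (Holds d G (t ∷ vs)) Ψ → Good d
    use-linked Φ Ψ solved {u} {t} ut u∉ t∉ hu ht =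
      solved G deg (u ∷ t ∷ vs)
        ( ((λ u≡t → adj-irrefl G u≡t ut) ∷ fresh⇒distinct vs u∉) ∷ fresh⇒distinct vs t∉ ∷ uvs)
        ( ut ∷ ++⁺ (rename-holds (punchIn 1F) (λ { 0F → refl ; (suc _) → refl }) hu)
                   (rename-holds suc (λ _ → refl) (++⁺ ht (rename-holds suc (λ _ → refl) hs))))

    use-two-more : ∀ Φ Ψ → Solved d (one-more (one-more P Φ) Ψ) → ∀ {u t} →
                   u ∉ toList vs → t ∉ toList vs → t ≢ u →
                   All (Holds d G (u ∷ vs)) Φ → All (Holds d G (t ∷ u ∷ vs)) Ψ → Good d
    use-two-more Φ Ψ solved {u} {t} u∉ t∉ t≢u hu ht =
      solved G deg (t ∷ u ∷ vs) ((t≢u ∷ fresh⇒distinct vs t∉) ∷ fresh⇒distinct vs u∉ ∷ uvs)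
        (++⁺ ht (rename-holds suc (λ _ → refl) (++⁺ hu (rename-holds suc (λ _ → refl) hs))))

    -- If an outer vertex attached to any vertex of `is` leads to a butterfly, then one may assume
    -- that it is adjacent to none of them.
    detach : ∀ {is} → All (λ i → Solved d (one-more P (0F ~ suc i ∷ []))) is →
             ∀ {u} → u ∉ toList vs → Good d ⊎ All (Holds d G (u ∷ vs)) (apart is)
    detach attached {u} u∉ with traverse (All.map (λ {i} → choose i) attached)
      where
      choose : ∀ i → Solved d (one-more P (0F ~ suc i ∷ [])) → Good d ⊎ (¬ Adj G u (lookup vs i))
      choose i solved with adj? G u (lookup vs i)
      ... | yes ui = inj₁ (use-one-more (0F ~ suc i ∷ []) solved u∉ (ui ∷ []))
      ... | no ¬ui = inj₂ ¬ui
    ... | inj₁ good = inj₁ good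
    ... | inj₂ none = inj₂ (AllP.map⁺ none)

  apart-holds⁻ : ∀ {G k u} {vs : Vec (Fin n) k} is → All (Holds d G (u ∷ vs)) (apart is) →
                 All (λ i → ¬ Adj G u (lookup vs i)) is
  apart-holds⁻ is hu = AllP.map⁻ {xs = is} hu

  -- If no outer vertex can be attached to an occurrence of P, then P spans the graph.
  spanning-solved : (∀ u → 0 < d u) → (P : Pattern) →
    (∀ i → Solved d (one-more P (0F ~ suc i ∷ []))) →
    Solved d (linked P (apart (allFin _)) (apart (allFin _))) →
    (∀ i → T (all (settled (facts P) i) (allFin _))) →
    ¬ (n ≡ order P × map d (allFin n) ↭ map (pattern-degree (facts P)) (allFin (order P))) →
    Solved d P
  spanning-solved pos P attached isolated complete ¬spanning G deg vs uvs hs with complement (toList-unique uvs)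
  ... | [] , p , _ = contradiction (n≡ , ↭-trans (Perm.map⁺ d p) (↭-reflexive degrees)) ¬spanning
    where
    open ≡-Reasoning
    n≡ : n ≡ order P
    n≡ = trans (complement-length {xs = toList vs} p) (trans (+-identityʳ _) (length-toList vs))
    degrees : map d (toList vs ++ []) ≡ map (pattern-degree (facts P)) (allFin (order P))
    degrees = begin
      map d (toList vs ++ [])                          ≡⟨ cong (map d) (trans (++-identityʳ _) (toList-lookup vs)) ⟩
      map d (map (lookup vs) (allFin (order P)))       ≡⟨ map-∘ (allFin (order P)) ⟨
      map (d ∘ lookup vs) (allFin (order P))
        ≡⟨ map-cong (λ i → trans (sym (deg _)) (degree-settled i p [] (complete i) hs)) (allFin (order P)) ⟩
      map (pattern-degree (facts P)) (allFin (order P)) ∎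
  -- An outer vertex `u` has positive degree but no neighbour in the occurrence, so its neighbour
  -- `t` is outer as well; the edge `ut` is what `isolated` treats.
  ... | u ∷ _ , _ , u∉ ∷ _ with detach P deg uvs hs (All.universal attached (allFin _)) u∉
                              | further-neighbour G {u} {[]} [] (subst (0 <_) (sym (deg u)) (pos u))
  ... | inj₁ good | _ = good
  ... | inj₂ hu | t , ut , _ with lookup-or-fresh t vs
  ... | inj₁ (i , refl) = contradiction ut (All.lookup (apart-holds⁻ (allFin _) hu) (∈-allFin i))
  ... | inj₂ t∉ with detach P deg uvs hs (All.universal attached (allFin _)) t∉
  ... | inj₁ good = good
  ... | inj₂ ht = use-linked P deg uvs hs (apart (allFin _)) (apart (allFin _)) isolated ut u∉ t∉ hu ht

-- The excluded sequences enter as multisets, since the vertices of a realization are not ordered by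
-- degree.
record Unexceptional {n} (d : Fin n → ℕ) : Set where
  field
    positive  : ∀ u → 0 < d u
    not-K₂,ₘ  : n ≥ 6 → ¬ (map d (allFin n) ↭ replicate 2 (n ∸ 2) ++ replicate (n ∸ 2) 2)
    not-book  : ∀ k i → 1 ≤ k → k ≤ (n ∸ 1) / 2 ∸ 1 → 3 ≤ i → i ≤ n ∸ 2 * k →
                ¬ (map d (allFin n) ↭ (n ∸ k) ∷ (k + i) ∷ replicate i 2 ++ replicate (n ∸ i ∸ 2) 1)
    not-six   : n ≡ 6 → ¬ (map d (allFin n) ↭ 4 ∷ replicate 5 2)
    not-seven : n ≡ 7 → ¬ (map d (allFin n) ↭ 4 ∷ replicate 6 2)

-- The exceptional structures

-- The vertices `v` and `w` meet every edge. This is the common shape of the enlarged `K₂,₄` and of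
-- the book with further pages and leaves.
module Spine {n} (G : Graph n) {v w : Fin n} {Q : List (Fin n)} (cover : allFin n ↭ v ∷ w ∷ Q)
             (indep : All (λ x → All (¬_ ∘ Adj G x) Q) Q) where

  order≡ : n ≡ 2 + length Q
  order≡ = complement-length {xs = v ∷ w ∷ []} cover

  page-degree : All (λ x → degree G x ≡ row G v x + row G w x) Q
  page-degree = All.map (λ {x} none → begin
    degree G x                                         ≡⟨ degree-split G x (v ∷ w ∷ []) cover ⟩
    row G x v + (row G x w + 0) + ∑ (row G x) Q
      ≡⟨ cong₂ _+_ (cong₂ _+_ (row-sym G x v) (trans (+-identityʳ _) (row-sym G x w)))
                   (∑-zero (All.map (row-nonadj G) none)) ⟩
    row G v x + row G w x + 0                          ≡⟨ +-identityʳ _ ⟩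
    row G v x + row G w x                              ∎) indep
    where open ≡-Reasoning

  spine-degreeˡ : degree G v ≡ row G v w + ∑ (row G v) Q
  spine-degreeˡ = trans (degree-split G v (v ∷ w ∷ []) cover)
    (cong (_+ ∑ (row G v) Q) (cong₂ _+_ (row-self G v) (+-identityʳ _)))

  spine-degreeʳ : degree G w ≡ row G v w + ∑ (row G w) Q
  spine-degreeʳ = trans (degree-split G w (v ∷ w ∷ []) cover)
    (cong (_+ ∑ (row G w) Q) (trans (cong₂ _+_ (row-sym G w v) (cong (_+ 0) (row-self G w))) (+-identityʳ _)))

map-const : ∀ {A : Set} {f : A → ℕ} {c xs} → All (λ x → f x ≡ c) xs → map f xs ≡ replicate (length xs) c
map-const []         = refl
map-const (eq ∷ eqs) = cong₂ _∷_ eq (map-const eqs)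

sum-replicate : ∀ k c → sum (replicate k c) ≡ k * c
sum-replicate zero    c = refl
sum-replicate (suc k) c = cong (c +_) (sum-replicate k c)

ones-and-twos : ∀ {ys} → All (λ y → y ≡ 1 ⊎ y ≡ 2) ys → ∃₂ λ i j → ys ↭ replicate i 2 ++ replicate j 1
ones-and-twos []                 = 0 , 0 , ↭-refl
ones-and-twos (inj₁ refl ∷ ones) =
  let i , j , p = ones-and-twos ones
  in  i , suc j , ↭-trans (prep 1 p) (↭-sym (Perm.shift 1 (replicate i 2) (replicate j 1)))
ones-and-twos (inj₂ refl ∷ ones) =
  let i , j , p = ones-and-twos ones
  in  suc i , j , prep 2 p

-- In a book with i pages, j further leaves and spine degrees 1 + a and 1 + b,
-- the parameter k of the exceptional sequences is one more than the number e
-- of leaves at the second spine vertex.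
module _ {n a b i j e : ℕ} (n≡ : n ≡ 2 + (i + j)) (a+b≡ : a + b ≡ i * 2 + j * 1) (a+e≡ : a + e ≡ i + j)
         (b≤a : b ≤ a) (3≤i : 3 ≤ i) where

  b≡e+i : b ≡ e + i
  b≡e+i = +-cancelˡ-≡ a b (e + i) (begin
    a + b          ≡⟨ a+b≡ ⟩
    i * 2 + j * 1  ≡⟨ expand i j ⟩
    i + j + i      ≡⟨ cong (_+ i) a+e≡ ⟨
    a + e + i      ≡⟨ +-assoc a e i ⟩
    a + (e + i)    ∎)
    where
    open ≡-Reasoning
    expand : ∀ i j → i * 2 + j * 1 ≡ i + j + i
    expand = solve-∀

  -- As `b ≡ e + i` counts the leaves and pages at the smaller spine vertex, `b ≤ a` bounds
  -- `2 * e + i` by the number of all pages and leaves.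
  2e+i≤i+j : 2 * e + i ≤ i + j
  2e+i≤i+j = begin
    2 * e + i    ≡⟨ rearrange e i ⟩
    (e + i) + e  ≡⟨ cong (_+ e) b≡e+i ⟨
    b + e        ≤⟨ +-monoˡ-≤ e b≤a ⟩
    a + e        ≡⟨ a+e≡ ⟩
    i + j        ∎
    where
    open ≤-Reasoning
    rearrange : ∀ e i → 2 * e + i ≡ (e + i) + e
    rearrange = solve-∀

  -- The bound amounts to `(2 + e) * 2 ≤ n ∸ 1`, and `3 ≤ i` derives this from the preceding
  -- inequality.
  k-bound : suc e ≤ (n ∸ 1) / 2 ∸ 1
  k-bound = ∸-monoˡ-≤ 1 (subst (_≤ (n ∸ 1) / 2) (m*n/n≡m (2 + e) 2) (/-monoˡ-≤ 2 (begin
    (2 + e) * 2        ≡⟨ rearrange e ⟩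
    1 + (2 * e + 3)    ≤⟨ s≤s (+-monoʳ-≤ (2 * e) 3≤i) ⟩
    1 + (2 * e + i)    ≤⟨ s≤s 2e+i≤i+j ⟩
    1 + (i + j)        ≡⟨ cong (_∸ 1) n≡ ⟨
    n ∸ 1              ∎)))
    where
    open ≤-Reasoning
    rearrange : ∀ e → (2 + e) * 2 ≡ 1 + (2 * e + 3)
    rearrange = solve-∀

  i-bound : i ≤ n ∸ 2 * suc e
  i-bound = m+n≤o⇒m≤o∸n i (begin
    i + 2 * suc e      ≡⟨ rearrange i e ⟩
    2 + (2 * e + i)    ≤⟨ s≤s (s≤s 2e+i≤i+j) ⟩
    2 + (i + j)        ≡⟨ n≡ ⟨
    n                  ∎)
    where
    open ≤-Reasoning
    rearrange : ∀ i e → i + 2 * suc e ≡ 2 + (2 * e + i)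
    rearrange = solve-∀

  n∸k≡ : n ∸ suc e ≡ suc a
  n∸k≡ = trans (cong (_∸ suc e) (trans n≡ (trans (cong (2 +_) (sym a+e≡)) (sym (+-suc (suc a) e))))) (m+n∸n≡m (suc a) (suc e))

  leaves≡ : n ∸ i ∸ 2 ≡ j
  leaves≡ = cong (_∸ 2) (trans (cong (_∸ i) (trans n≡ (rearrange i j))) (m+n∸m≡n i (2 + j)))
    where
    rearrange : ∀ i j → 2 + (i + j) ≡ i + (2 + j)
    rearrange = solve-∀

module _ {n} {d : Fin n → ℕ} (U : Unexceptional d) where

  open Unexceptional U

  spindle-exceptional : ∀ {G} → degree G ≗ d → ∀ {v w Q} → allFin n ↭ v ∷ w ∷ Q →
    All (λ x → All (¬_ ∘ Adj G x) Q) Q → ¬ Adj G v w → All (λ x → Adj G v x × Adj G w x) Q → ¬ 4 ≤ length Q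
  spindle-exceptional {G} deg {v} {w} {Q} cover indep ¬vw spokes 4≤ =
    not-K₂,ₘ (subst (6 ≤_) (sym order≡) (s≤s (s≤s 4≤))) (↭-trans (Perm.map⁺ d cover) (↭-reflexive degrees))
    where
    open Spine G cover indep
    len≡ : length Q ≡ n ∸ 2
    len≡ = cong (_∸ 2) (sym order≡)
    spine : ∀ {x} → degree G x ≡ row G v w + ∑ (row G x) Q → All (Adj G x) Q → d x ≡ n ∸ 2
    spine {x} eq adj = begin
      d x                        ≡⟨ deg x ⟨
      degree G x                 ≡⟨ eq ⟩
      row G v w + ∑ (row G x) Q  ≡⟨ cong₂ _+_ (row-nonadj G ¬vw) (∑-const (All.map (row-adj G) adj)) ⟩
      length Q * 1               ≡⟨ *-identityʳ _ ⟩
      length Q                   ≡⟨ len≡ ⟩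
      n ∸ 2                      ∎
      where open ≡-Reasoning
    pages : All (λ x → d x ≡ 2) Q
    pages = All.zipWith (λ { (eq , vx , wx) → trans (sym (deg _)) (trans eq (cong₂ _+_ (row-adj G vx) (row-adj G wx))) })
              (page-degree , spokes)
    degrees : map d (v ∷ w ∷ Q) ≡ replicate 2 (n ∸ 2) ++ replicate (n ∸ 2) 2
    degrees = cong₂ _∷_ (spine spine-degreeˡ (All.map proj₁ spokes))
             (cong₂ _∷_ (spine spine-degreeʳ (All.map proj₂ spokes))
                        (trans (map-const pages) (cong (λ k → replicate k 2) len≡)))

  book-exceptional : ∀ {G} → degree G ≗ d → ∀ {v w Q} → allFin n ↭ v ∷ w ∷ Q →
    All (λ x → All (¬_ ∘ Adj G x) Q) Q → Adj G v w →
    ∀ {i j} → map d Q ↭ replicate i 2 ++ replicate j 1 → ¬ 3 ≤ i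
  book-exceptional {G} deg {v} {w} {Q} cover indep vw {i} {j} pages 3≤i = conclude (≤-total b a)
    where
    open Spine G cover indep
    a b : ℕ
    a = ∑ (row G v) Q
    b = ∑ (row G w) Q
    dv≡ : d v ≡ suc a
    dv≡ = trans (sym (deg v)) (trans spine-degreeˡ (cong (_+ a) (row-adj G vw)))
    dw≡ : d w ≡ suc b
    dw≡ = trans (sym (deg w)) (trans spine-degreeʳ (cong (_+ b) (row-adj G vw)))
    len≡ : length Q ≡ i + j
    len≡ = begin
      length Q                                    ≡⟨ length-map d Q ⟨
      length (map d Q)                            ≡⟨ Perm.↭-length pages ⟩
      length (replicate i 2 ++ replicate j 1)     ≡⟨ length-++ (replicate i 2) ⟩
      length (replicate i 2) + length (replicate j 1) ≡⟨ cong₂ _+_ (length-replicate i) (length-replicate j) ⟩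
      i + j                                       ∎
      where open ≡-Reasoning
    n≡ : n ≡ 2 + (i + j)
    n≡ = trans order≡ (cong (2 +_) len≡)
    a+b≡ : a + b ≡ i * 2 + j * 1
    a+b≡ = begin
      a + b                                       ≡⟨ ∑-+ (row G v) (row G w) Q ⟨
      ∑ (λ x → row G v x + row G w x) Q
        ≡⟨ cong sum (map-cong-local (All.map (λ {x} eq → trans (sym eq) (deg x)) page-degree)) ⟩
      sum (map d Q)                               ≡⟨ sum-↭ pages ⟩
      sum (replicate i 2 ++ replicate j 1)        ≡⟨ sum-++ (replicate i 2) (replicate j 1) ⟩
      sum (replicate i 2) + sum (replicate j 1)   ≡⟨ cong₂ _+_ (sum-replicate i 2) (sum-replicate j 1) ⟩
      i * 2 + j * 1                               ∎
      where open ≡-Reasoning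

    -- `a` and `b` are bound afresh so that the spine vertices can be exchanged: the excluded
    -- sequences list the larger spine degree first. The `e` below counts the vertices of `Q` that
    -- the first spine vertex misses.
    exceptional : ∀ {a b} → a + b ≡ i * 2 + j * 1 → a ≤ i + j → b ≤ a →
                  ¬ (map d (allFin n) ↭ suc a ∷ suc b ∷ replicate i 2 ++ replicate j 1)
    exceptional {a} {b} a+b≡ a≤ b≤a p with m≤n⇒∃[o]m+o≡n a≤
    ... | e , a+e≡ =
      not-book (suc e) i (s≤s z≤n) (k-bound n≡ a+b≡ a+e≡ b≤a 3≤i) 3≤i (i-bound n≡ a+b≡ a+e≡ b≤a 3≤i)
        (↭-trans p (↭-reflexive (cong₂ _∷_ (sym (n∸k≡ n≡ a+b≡ a+e≡ b≤a 3≤i))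
          (cong₂ _∷_ (cong suc (b≡e+i n≡ a+b≡ a+e≡ b≤a 3≤i))
            (cong (λ k → replicate i 2 ++ replicate k 1) (sym (leaves≡ n≡ a+b≡ a+e≡ b≤a 3≤i)))))))

    degrees : map d (allFin n) ↭ suc a ∷ suc b ∷ replicate i 2 ++ replicate j 1
    degrees = ↭-trans (Perm.map⁺ d cover)
      (↭-trans (prep (d v) (prep (d w) pages)) (↭-reflexive (cong₂ (λ x y → x ∷ y ∷ _) dv≡ dw≡)))

    small : ∀ x → ∑ (row G x) Q ≤ i + j
    small x = subst (∑ (row G x) Q ≤_) len≡ (∑-row≤length G x Q)

    conclude : ¬ (b ≤ a ⊎ a ≤ b)
    conclude (inj₁ b≤a) = exceptional a+b≡ (small v) b≤a degrees
    conclude (inj₂ a≤b) = exceptional (trans (+-comm b a) a+b≡) (small w) a≤b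
      (↭-trans degrees (swap (suc a) (suc b) ↭-refl))

-- Solving the patterns

pattern to-butterfly    = here refl
pattern to-K₂,₄         = there to-butterfly
pattern to-book         = there to-K₂,₄
pattern to-C₃·C₄        = there to-book
pattern to-C₃·C₅        = there to-C₃·C₄
pattern to-tailed       = there to-C₃·C₅
pattern to-path         = there to-tailed
pattern to-loose        = there to-path
pattern to-edge         = there to-loose
pattern to-independent₄ = there to-edge

-- The facts leave `z` as the only possible neighbour of `i` among the named vertices.
nonadjacent-except : ∀ {k} → List (Fact k) → (z i : Fin k) → Bool
nonadjacent-except {k} Φ z i = all (λ j → ⌊ j ≟ z ⌋ ∨ known Φ (i ≁ j) ∨ ⌊ i ≟ j ⌋) (allFin k)

refute : ∀ {a} {A : Set a} {B : Set} → Dec B → (B → A) → A ⊎ ¬ B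
refute (yes b) f = inj₁ (f b)
refute (no ¬b) _ = inj₂ ¬b

pairwise : ∀ {a} {A : Set a} {B : Set} {P : B → Set} {R : B → B → Set} →
           (∀ {x y} → P x → P y → A ⊎ R x y) → ∀ {xs} → All P xs → A ⊎ All (λ x → All (R x) xs) xs
pairwise f ps = traverse (All.map (λ px → traverse (All.map (f px) ps)) ps)

one-or-two : ∀ {m} b c → m ≡ bit b + bit c → 0 < m → m ≡ 1 ⊎ m ≡ 2
one-or-two false true  eq _ = inj₁ eq
one-or-two true  false eq _ = inj₁ eq
one-or-two true  true  eq _ = inj₂ eq
one-or-two false false refl ()

-- Each pattern is solved from earlier ones. The lists of solved patterns only grow at the end, so
-- that `to-butterfly` and its companions name the same positions in all of them.
module Solutions {n} {d : Fin n → ℕ} (U : Unexceptional d) where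

  open Unexceptional U

  solved₁ : All (Solved d) (butterfly ∷ [])
  solved₁ = butterfly-solved d ∷ []

  C₃·C₄-solved : Solved d C₃·C₄
  C₃·C₄-solved = spanning-solved d positive C₃·C₄ attached
    (certified d solved₁ _
      -- Together the switches trade the isolated edge from `0F` to `1F` and the path `2F`, `5F`,
      -- `7F` for the path `0F`, `5F`, `1F` and the chord from `2F` to `7F`, which closes a second
      -- triangle at the centre `2F`.
      (switch 0F 1F 2F 5F (switch 0F 2F 5F 7F (reach to-butterfly (2F ∷ 3F ∷ 4F ∷ 6F ∷ 7F ∷ [])))))
    (λ { 0F → _ ; 1F → _ ; 2F → _ ; 3F → _ ; 4F → _ ; 5F → _ })
    λ (n≡6 , p) → not-six n≡6 p
    where
    attached : ∀ i → Solved d (one-more C₃·C₄ (0F ~ suc i ∷ []))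
    attached 0F = certified d solved₁ _
      (query 0F 2F
       (switch 1F 3F 6F 4F (reach to-butterfly (1F ∷ 0F ∷ 2F ∷ 5F ∷ 6F ∷ [])))
       (query 0F 3F
        (switch 1F 2F 6F 4F (reach to-butterfly (1F ∷ 0F ∷ 3F ∷ 5F ∷ 6F ∷ [])))
        (query 0F 4F
         (reach to-butterfly (1F ∷ 0F ∷ 4F ∷ 2F ∷ 3F ∷ []))
         (switch 0F 1F 4F 6F (reach to-butterfly (1F ∷ 2F ∷ 3F ∷ 5F ∷ 6F ∷ []))))))
    attached 1F = certified d solved₁ _
      (query 0F 1F
       (switch 1F 3F 6F 4F (reach to-butterfly (1F ∷ 0F ∷ 2F ∷ 5F ∷ 6F ∷ [])))
       (query 0F 3F
        (switch 0F 2F 1F 4F (switch 2F 3F 5F 6F (reach to-butterfly (1F ∷ 0F ∷ 3F ∷ 2F ∷ 5F ∷ []))))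
        (switch 1F 2F 6F 4F (switch 0F 2F 3F 1F (reach to-butterfly (1F ∷ 2F ∷ 4F ∷ 5F ∷ 6F ∷ []))))))
    -- The pattern has a symmetry exchanging two vertices of its triangle, so this case is a
    -- relabelling of the one before. The other one-line cases below arise in the same way.
    attached 2F = certified d (attached 1F ∷ []) _ (reach (here refl) (0F ∷ 1F ∷ 3F ∷ 2F ∷ 4F ∷ 5F ∷ 6F ∷ []))
    attached 3F = certified d solved₁ _
      (query 0F 1F
       (reach to-butterfly (1F ∷ 0F ∷ 4F ∷ 2F ∷ 3F ∷ []))
       (query 0F 2F
        (switch 0F 2F 1F 5F (reach to-butterfly (1F ∷ 0F ∷ 4F ∷ 2F ∷ 3F ∷ [])))
        (switch 0F 4F 2F 3F (switch 1F 2F 6F 4F (reach to-butterfly (1F ∷ 3F ∷ 4F ∷ 5F ∷ 6F ∷ []))))))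
    attached 4F = certified d (attached 3F ∷ []) _ (reach (here refl) (0F ∷ 1F ∷ 2F ∷ 3F ∷ 5F ∷ 4F ∷ 6F ∷ []))
    attached 5F = certified d solved₁ _
      (query 0F 1F
       (switch 1F 4F 6F 5F (reach to-butterfly (1F ∷ 0F ∷ 6F ∷ 2F ∷ 3F ∷ [])))
       (query 0F 2F
        (switch 0F 2F 1F 4F (switch 1F 5F 6F 4F (reach to-butterfly (1F ∷ 0F ∷ 6F ∷ 2F ∷ 3F ∷ []))))
        (switch 0F 6F 2F 1F (switch 2F 3F 6F 4F (reach to-butterfly (1F ∷ 3F ∷ 4F ∷ 5F ∷ 6F ∷ []))))))

  C₃·C₅-solved : Solved d C₃·C₅
  C₃·C₅-solved = spanning-solved d positive C₃·C₅ attached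
    (certified d solved₁ _
      (switch 0F 1F 2F 5F (switch 0F 2F 7F 8F (reach to-butterfly (2F ∷ 3F ∷ 4F ∷ 6F ∷ 8F ∷ [])))))
    (λ { 0F → _ ; 1F → _ ; 2F → _ ; 3F → _ ; 4F → _ ; 5F → _ ; 6F → _ })
    λ (n≡7 , p) → not-seven n≡7 p
    where
    attached : ∀ i → Solved d (one-more C₃·C₅ (0F ~ suc i ∷ []))
    attached 0F = certified d solved₁ _
      (query 0F 2F
       (switch 1F 3F 6F 7F (reach to-butterfly (1F ∷ 0F ∷ 2F ∷ 4F ∷ 6F ∷ [])))
       (query 0F 3F
        (switch 1F 2F 6F 7F (reach to-butterfly (1F ∷ 0F ∷ 3F ∷ 4F ∷ 6F ∷ [])))
        (query 0F 4F
         (reach to-butterfly (1F ∷ 0F ∷ 4F ∷ 2F ∷ 3F ∷ []))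
         (query 0F 5F
          (reach to-butterfly (1F ∷ 0F ∷ 5F ∷ 2F ∷ 3F ∷ []))
          (query 0F 6F
           (switch 0F 6F 5F 1F (reach to-butterfly (1F ∷ 2F ∷ 3F ∷ 4F ∷ 6F ∷ [])))
           (switch 0F 1F 6F 7F (reach to-butterfly (1F ∷ 2F ∷ 3F ∷ 5F ∷ 7F ∷ []))))))))
    attached 1F = certified d solved₁ _
      (query 0F 1F
       (switch 1F 3F 6F 7F (reach to-butterfly (1F ∷ 0F ∷ 2F ∷ 4F ∷ 6F ∷ [])))
       (query 0F 3F
        (switch 0F 2F 1F 4F (switch 1F 2F 7F 6F (reach to-butterfly (1F ∷ 0F ∷ 3F ∷ 5F ∷ 7F ∷ []))))
        (query 0F 4F
         (switch 0F 2F 1F 5F (reach to-butterfly (1F ∷ 0F ∷ 4F ∷ 2F ∷ 3F ∷ [])))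
         (switch 0F 2F 4F 6F (switch 1F 4F 7F 6F (reach to-butterfly (1F ∷ 2F ∷ 3F ∷ 5F ∷ 7F ∷ [])))))))
    attached 2F = certified d (attached 1F ∷ []) _ (reach (here refl) (0F ∷ 1F ∷ 3F ∷ 2F ∷ 4F ∷ 5F ∷ 6F ∷ 7F ∷ []))
    attached 3F = certified d solved₁ _
      (query 0F 1F
       (reach to-butterfly (1F ∷ 0F ∷ 4F ∷ 2F ∷ 3F ∷ []))
       (query 0F 2F
        (switch 0F 2F 1F 5F (reach to-butterfly (1F ∷ 0F ∷ 4F ∷ 2F ∷ 3F ∷ [])))
        (switch 0F 4F 2F 3F (switch 1F 2F 7F 6F (reach to-butterfly (1F ∷ 3F ∷ 4F ∷ 5F ∷ 7F ∷ []))))))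
    attached 4F = certified d (attached 3F ∷ []) _ (reach (here refl) (0F ∷ 1F ∷ 2F ∷ 3F ∷ 5F ∷ 4F ∷ 7F ∷ 6F ∷ []))
    attached 5F = certified d solved₁ _
      (query 0F 1F
       (switch 1F 4F 6F 7F (reach to-butterfly (1F ∷ 0F ∷ 6F ∷ 2F ∷ 3F ∷ [])))
       (query 0F 2F
        (switch 0F 2F 1F 4F (switch 1F 5F 6F 4F (reach to-butterfly (1F ∷ 0F ∷ 6F ∷ 2F ∷ 3F ∷ []))))
        (switch 0F 6F 2F 1F (switch 1F 3F 7F 6F (reach to-butterfly (1F ∷ 4F ∷ 6F ∷ 5F ∷ 7F ∷ []))))))
    attached 6F = certified d (attached 5F ∷ []) _ (reach (here refl) (0F ∷ 1F ∷ 2F ∷ 3F ∷ 5F ∷ 4F ∷ 7F ∷ 6F ∷ []))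

  module Spindle {G} (deg : degree G ≗ d) {vs} (uvs : Uniqueᵛ vs) (hs : All (Holds d G vs) (facts K₂,₄)) where

    pages : List (Fin 6)
    pages = 2F ∷ 3F ∷ 4F ∷ 5F ∷ []

    spoke far : List (Fact 7)
    spoke = 0F ~ 1F ∷ 0F ~ 2F ∷ apart pages
    far   = 0F ≁ 1F ∷ 0F ≁ 2F ∷ apart pages

    page-attached : All (λ i → Solved d (one-more K₂,₄ (0F ~ suc i ∷ []))) pages
    page-attached = first ∷ second ∷ third ∷ fourth ∷ []
      where
      first : Solved d (one-more K₂,₄ (0F ~ 3F ∷ []))
      first = certified d solved₁ _
        (query 0F 1F
         (switch 1F 4F 2F 3F (reach to-butterfly (1F ∷ 0F ∷ 3F ∷ 2F ∷ 5F ∷ [])))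
         (switch 0F 3F 1F 4F (switch 1F 3F 2F 5F (reach to-butterfly (2F ∷ 1F ∷ 6F ∷ 3F ∷ 4F ∷ [])))))
      second : Solved d (one-more K₂,₄ (0F ~ 4F ∷ []))
      second = certified d (first ∷ []) _ (reach (here refl) (0F ∷ 1F ∷ 2F ∷ 4F ∷ 3F ∷ 5F ∷ 6F ∷ []))
      third : Solved d (one-more K₂,₄ (0F ~ 5F ∷ []))
      third = certified d (first ∷ []) _ (reach (here refl) (0F ∷ 1F ∷ 2F ∷ 5F ∷ 3F ∷ 4F ∷ 6F ∷ []))
      fourth : Solved d (one-more K₂,₄ (0F ~ 6F ∷ []))
      fourth = certified d (first ∷ []) _ (reach (here refl) (0F ∷ 1F ∷ 2F ∷ 6F ∷ 3F ∷ 4F ∷ 5F ∷ []))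

    -- Adjacency to a page, or to exactly one spine vertex, already leads to a butterfly; both or
    -- neither of the spine vertices remain.
    classify : ∀ {u} → u ∉ toList vs → Good d ⊎ (All (Holds d G (u ∷ vs)) spoke ⊎ All (Holds d G (u ∷ vs)) far)
    classify {u} u∉ = [ inj₁ , by-spine (adj? G u (lookup vs 0F)) (adj? G u (lookup vs 1F)) ]′
                        (detach d K₂,₄ deg uvs hs page-attached u∉)
      where
      by-spine : Dec (Adj G u (lookup vs 0F)) → Dec (Adj G u (lookup vs 1F)) → All (Holds d G (u ∷ vs)) (apart pages) →
                 Good d ⊎ (All (Holds d G (u ∷ vs)) spoke ⊎ All (Holds d G (u ∷ vs)) far)
      by-spine (yes uv) (yes uw) none = inj₂ (inj₁ (uv ∷ uw ∷ none))
      by-spine (no ¬uv) (no ¬uw) none = inj₂ (inj₂ (¬uv ∷ ¬uw ∷ none))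
      by-spine (yes uv) (no ¬uw) none = inj₁ (use-one-more d K₂,₄ deg uvs hs (0F ~ 1F ∷ 0F ≁ 2F ∷ apart pages)
        (certified d solved₁ _
          (switch 0F 1F 3F 2F (switch 0F 3F 2F 4F (reach to-butterfly (1F ∷ 2F ∷ 5F ∷ 3F ∷ 4F ∷ [])))))
        u∉ (uv ∷ ¬uw ∷ none))
      by-spine (no ¬uv) (yes uw) none = inj₁ (use-one-more d K₂,₄ deg uvs hs (0F ≁ 1F ∷ 0F ~ 2F ∷ apart pages)
        (certified d solved₁ _
          (switch 0F 2F 3F 1F (switch 0F 3F 1F 4F (reach to-butterfly (2F ∷ 1F ∷ 5F ∷ 3F ∷ 4F ∷ [])))))
        u∉ (¬uv ∷ uw ∷ none))

    -- A `far` vertex has some neighbour, which is again outer and hence a `spoke` or `far`; an edge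
    -- of either kind leads to a butterfly.
    outer-spoke : ∀ {u} → u ∉ toList vs → Good d ⊎ All (Holds d G (u ∷ vs)) spoke
    outer-spoke {u} u∉ = [ inj₁ , [ inj₂ , inj₁ ∘ not-far ]′ ]′ (classify u∉)
      where
      not-far : All (Holds d G (u ∷ vs)) far → Good d
      not-far hu = let _ , ut , _ = further-neighbour G [] (subst (0 <_) (sym (deg u)) (positive u)) in beside ut
        where
        beside-spoke : ∀ {t} → Adj G u t → t ∉ toList vs → All (Holds d G (t ∷ vs)) spoke → Good d
        beside-spoke ut t∉ ht = use-linked d K₂,₄ deg uvs hs spoke far
          (certified d solved₁ _
            (switch 0F 1F 4F 2F (switch 0F 2F 5F 3F (reach to-butterfly (3F ∷ 0F ∷ 4F ∷ 2F ∷ 6F ∷ [])))))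
          (adj-sym G ut) t∉ u∉ ht hu
        beside-far : ∀ {t} → Adj G u t → t ∉ toList vs → All (Holds d G (t ∷ vs)) far → Good d
        beside-far ut t∉ ht = use-linked d K₂,₄ deg uvs hs far far
          (certified d solved₁ _
            (switch 0F 1F 2F 4F (switch 0F 2F 5F 3F (switch 0F 5F 3F 6F (reach to-butterfly (2F ∷ 3F ∷ 7F ∷ 5F ∷ 6F ∷ []))))))
          ut u∉ t∉ hu ht
        beside : ∀ {t} → Adj G u t → Good d
        beside {t} ut =
          [ (λ { (i , refl) → contradiction ut (All.lookup (apart-holds⁻ d (allFin 6) hu) (∈-allFin i)) })
          , (λ t∉ → [ id , [ beside-spoke ut t∉ , beside-far ut t∉ ]′ ]′ (classify t∉))
          ]′ (lookup-or-fresh t vs)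

    spokes-nonadjacent : ∀ {u t} → u ∉ toList vs → t ∉ toList vs → All (Holds d G (u ∷ vs)) spoke →
                         All (Holds d G (t ∷ vs)) spoke → Good d ⊎ ¬ Adj G u t
    spokes-nonadjacent {u} {t} u∉ t∉ hu ht = refute (adj? G u t) λ ut →
      use-linked d K₂,₄ deg uvs hs spoke spoke
        (certified d solved₁ _
          (switch 0F 2F 4F 3F (reach to-butterfly (3F ∷ 0F ∷ 1F ∷ 2F ∷ 5F ∷ []))))
        ut u∉ t∉ hu ht

  K₂,₄-solved : Solved d K₂,₄
  K₂,₄-solved G deg vs@(v ∷ w ∷ p₁ ∷ p₂ ∷ p₃ ∷ p₄ ∷ []) uvs
    hs@(v1 ∷ v2 ∷ v3 ∷ v4 ∷ w1 ∷ w2 ∷ w3 ∷ w4 ∷ ¬vw ∷ ¬12 ∷ ¬13 ∷ ¬14 ∷ ¬23 ∷ ¬24 ∷ ¬34 ∷ []) =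
    let rs , p , rs∉ = complement (toList-unique uvs)
    in  [ id , (λ spokes → [ id , (λ indep → ⊥-elim (exceptional p spokes indep)) ]′ (outer-independent rs∉ spokes)) ]′
          (traverse (All.map outer-spoke rs∉))
    where
    open Spindle deg uvs hs
    irr : ∀ x → ¬ Adj G x x
    irr x = adj-irrefl G refl
    outer-independent : ∀ {rs} → All (_∉ toList vs) rs → All (λ u → All (Holds d G (u ∷ vs)) spoke) rs →
                  Good d ⊎ All (λ u → All (¬_ ∘ Adj G u) rs) rs
    outer-independent rs∉ spokes =
      pairwise (λ (u∉ , hu) (t∉ , ht) → spokes-nonadjacent u∉ t∉ hu ht) (All.zip (rs∉ , spokes))
    exceptional : ∀ {rs} → allFin n ↭ toList vs ++ rs → All (λ u → All (Holds d G (u ∷ vs)) spoke) rs →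
                  ¬ All (λ u → All (¬_ ∘ Adj G u) rs) rs
    exceptional p spokes indep = spindle-exceptional U {G} deg {v} {w} p
        ( (irr p₁ ∷ ¬12 ∷ ¬13 ∷ ¬14 ∷ All.map (λ { (_ ∷ _ ∷ x ∷ _) → x ∘ adj-sym G }) spokes)
        ∷ (¬12 ∘ adj-sym G ∷ irr p₂ ∷ ¬23 ∷ ¬24 ∷ All.map (λ { (_ ∷ _ ∷ _ ∷ x ∷ _) → x ∘ adj-sym G }) spokes)
        ∷ (¬13 ∘ adj-sym G ∷ ¬23 ∘ adj-sym G ∷ irr p₃ ∷ ¬34 ∷ All.map (λ { (_ ∷ _ ∷ _ ∷ _ ∷ x ∷ _) → x ∘ adj-sym G }) spokes)
        ∷ (¬14 ∘ adj-sym G ∷ ¬24 ∘ adj-sym G ∷ ¬34 ∘ adj-sym G ∷ irr p₄ ∷ All.map (λ { (_ ∷ _ ∷ _ ∷ _ ∷ _ ∷ x ∷ _) → x ∘ adj-sym G }) spokes)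
        ∷ All.zipWith (λ { ((_ ∷ _ ∷ x1 ∷ x2 ∷ x3 ∷ x4 ∷ []) , none) → x1 ∷ x2 ∷ x3 ∷ x4 ∷ none }) (spokes , indep))
        ¬vw
        ((v1 , w1) ∷ (v2 , w2) ∷ (v3 , w3) ∷ (v4 , w4) ∷
          All.map (λ { (xv ∷ xw ∷ _) → adj-sym G xv , adj-sym G xw }) spokes)
        (s≤s (s≤s (s≤s (s≤s z≤n))))

  solved₂ : All (Solved d) (butterfly ∷ K₂,₄ ∷ [])
  solved₂ = butterfly-solved d ∷ K₂,₄-solved ∷ []

  book-pages : List (Fin 5)
  book-pages = 2F ∷ 3F ∷ 4F ∷ []

  book-page-attached : All (λ i → Solved d (one-more book (0F ~ suc i ∷ []))) book-pages
  book-page-attached = first ∷ second ∷ third ∷ []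
    where
    first : Solved d (one-more book (0F ~ 3F ∷ []))
    first = certified d solved₁ _
      (query 0F 1F
       (reach to-butterfly (1F ∷ 0F ∷ 3F ∷ 2F ∷ 4F ∷ []))
       (switch 0F 3F 1F 4F (reach to-butterfly (2F ∷ 1F ∷ 5F ∷ 3F ∷ 4F ∷ []))))
    second : Solved d (one-more book (0F ~ 4F ∷ []))
    second = certified d (first ∷ []) _ (reach (here refl) (0F ∷ 1F ∷ 2F ∷ 4F ∷ 3F ∷ 5F ∷ []))
    third : Solved d (one-more book (0F ~ 5F ∷ []))
    third = certified d (first ∷ []) _ (reach (here refl) (0F ∷ 1F ∷ 2F ∷ 5F ∷ 3F ∷ 4F ∷ []))

  -- Adjacency to the spine is left open and has to be queried. If `u` is adjacent to only one spine
  -- vertex and `t` not to that one, a switch along `ut` may use up the spine edge and make `u` a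
  -- fourth page. The result is an induced `K₂,₄`, which is therefore solved before `book`.
  book-outer-nonadjacent : ∀ {G} → degree G ≗ d → ∀ {vs} → Uniqueᵛ vs → All (Holds d G vs) (facts book) →
    ∀ {u t} → u ∉ toList vs → t ∉ toList vs → All (Holds d G (u ∷ vs)) (apart book-pages) →
    All (Holds d G (t ∷ vs)) (apart book-pages) → Good d ⊎ ¬ Adj G u t
  book-outer-nonadjacent {G} deg uvs hs {u} {t} u∉ t∉ hu ht = refute (adj? G u t) λ ut →
    use-linked d book deg uvs hs (apart book-pages) (apart book-pages)
      (certified d solved₂ _
        (query 0F 2F
         (query 1F 2F
          (reach to-butterfly (2F ∷ 0F ∷ 1F ∷ 3F ∷ 4F ∷ []))
          (query 0F 3F
           (switch 0F 1F 4F 2F (reach to-butterfly (3F ∷ 0F ∷ 4F ∷ 2F ∷ 5F ∷ [])))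
           (switch 0F 1F 3F 2F (reach to-K₂,₄ (2F ∷ 3F ∷ 0F ∷ 4F ∷ 5F ∷ 6F ∷ [])))))
         (query 1F 2F
          (query 1F 3F
           (switch 0F 1F 2F 4F (reach to-butterfly (3F ∷ 1F ∷ 4F ∷ 2F ∷ 5F ∷ [])))
           (switch 0F 1F 2F 3F (reach to-K₂,₄ (2F ∷ 3F ∷ 1F ∷ 4F ∷ 5F ∷ 6F ∷ []))))
          (switch 0F 1F 2F 4F (switch 1F 4F 2F 5F (reach to-butterfly (3F ∷ 2F ∷ 6F ∷ 4F ∷ 5F ∷ [])))))))
      ut u∉ t∉ hu ht

  book-solved : Solved d book
  book-solved G deg vs@(v ∷ w ∷ p₁ ∷ p₂ ∷ p₃ ∷ []) uvs
    hs@(vw ∷ v1 ∷ v2 ∷ v3 ∷ w1 ∷ w2 ∷ w3 ∷ ¬12 ∷ ¬13 ∷ ¬23 ∷ []) =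
    let rs , p , rs∉ = complement (toList-unique uvs)
    in  [ id , (λ outer → [ id , (λ indep → ⊥-elim (exceptional p outer indep)) ]′ (outer-independent rs∉ outer)) ]′
          (traverse (All.map (detach d book deg uvs hs book-page-attached) rs∉))
    where
    irr : ∀ x → ¬ Adj G x x
    irr x = adj-irrefl G refl
    outer-independent : ∀ {rs} → All (_∉ toList vs) rs → All (λ u → All (Holds d G (u ∷ vs)) (apart book-pages)) rs →
                  Good d ⊎ All (λ u → All (¬_ ∘ Adj G u) rs) rs
    outer-independent rs∉ outer =
      pairwise (λ (u∉ , hu) (t∉ , ht) → book-outer-nonadjacent deg uvs hs u∉ t∉ hu ht) (All.zip (rs∉ , outer))
    exceptional : ∀ {rs} → allFin n ↭ toList vs ++ rs → All (λ u → All (Holds d G (u ∷ vs)) (apart book-pages)) rs →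
                  ¬ All (λ u → All (¬_ ∘ Adj G u) rs) rs
    exceptional {rs} p outer indep =
      let i , j , q = ones-and-twos (AllP.map⁺ page-sizes)
      -- The three pages of the pattern have degree two; with them there are at least three twos, as
      -- the excluded sequences require.
      in  book-exceptional U {G} deg {v} {w} p indep′ vw {3 + i} {j} (twos {i} {j} q) (s≤s (s≤s (s≤s z≤n)))
      where
      Q : List (Fin n)
      Q = p₁ ∷ p₂ ∷ p₃ ∷ rs
      indep′ : All (λ x → All (¬_ ∘ Adj G x) Q) Q
      indep′ =
          (irr p₁ ∷ ¬12 ∷ ¬13 ∷ All.map (λ { (x ∷ _) → x ∘ adj-sym G }) outer)
        ∷ (¬12 ∘ adj-sym G ∷ irr p₂ ∷ ¬23 ∷ All.map (λ { (_ ∷ x ∷ _) → x ∘ adj-sym G }) outer)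
        ∷ (¬13 ∘ adj-sym G ∷ ¬23 ∘ adj-sym G ∷ irr p₃ ∷ All.map (λ { (_ ∷ _ ∷ x ∷ _) → x ∘ adj-sym G }) outer)
        ∷ All.zipWith (λ { ((x1 ∷ x2 ∷ x3 ∷ []) , none) → x1 ∷ x2 ∷ x3 ∷ none }) (outer , indep)
      sizes : All (λ x → degree G x ≡ row G v x + row G w x) Q
      sizes = Spine.page-degree G p indep′
      page-sizes : All (λ x → d x ≡ 1 ⊎ d x ≡ 2) rs
      page-sizes = All.map (λ {x} eq → one-or-two (does (adj? G v x)) (does (adj? G w x))
                                                 (trans (sym (deg x)) eq) (positive x))
                     (All.tail (All.tail (All.tail sizes)))
      two : ∀ {x} → Adj G v x → Adj G w x → x ∈ Q → d x ≡ 2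
      two vx wx x∈ = trans (sym (deg _)) (trans (All.lookup sizes x∈) (cong₂ _+_ (row-adj G vx) (row-adj G wx)))
      twos : ∀ {i j} → map d rs ↭ replicate i 2 ++ replicate j 1 → map d Q ↭ replicate (3 + i) 2 ++ replicate j 1
      twos q = ↭-trans
        (↭-reflexive (cong₂ _∷_ (two v1 w1 (here refl))
                     (cong₂ _∷_ (two v2 w2 (there (here refl)))
                     (cong₂ _∷_ (two v3 w3 (there (there (here refl)))) refl))))
        (prep 2 (prep 2 (prep 2 q)))

  solved₅ : All (Solved d) (butterfly ∷ K₂,₄ ∷ book ∷ C₃·C₄ ∷ C₃·C₅ ∷ [])
  solved₅ = butterfly-solved d ∷ K₂,₄-solved ∷ book-solved ∷ C₃·C₄-solved ∷ C₃·C₅-solved ∷ []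

  -- Degree at least two gives a neighbour other than `z`, and the recorded nonedges place it
  -- outside the occurrence.
  outer-neighbour : ∀ {k Φ G} → degree G ≗ d → {vs : Vec (Fin n) k} → All (Holds d G vs) Φ → (z i : Fin k) →
    {T (nonadjacent-except Φ z i)} → 2 ≤ d (lookup vs i) → ∃ λ p → Adj G (lookup vs i) p × p ∉ toList vs
  outer-neighbour {k} {Φ} {G} deg {vs} hs z i {t} deg≥2
    with further-neighbour G {lookup vs i} {lookup vs z ∷ []} ([] ∷ []) (subst (2 ≤_) (sym (deg _)) deg≥2)
  ... | p , ip , p∉ with lookup-or-fresh p vs
  ... | inj₂ fresh = p , ip , fresh
  ... | inj₁ (j , refl) = contradiction (All.lookup (AllP.all⁺ _ (allFin k) t) (∈-allFin j)) (impossible (j ≟ z) (i ≟ j))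
    where
    impossible : (a : Dec (j ≡ z)) (b : Dec (i ≡ j)) → ¬ T (⌊ a ⌋ ∨ known Φ (i ≁ j) ∨ ⌊ b ⌋)
    impossible (yes refl) _          _ = p∉ (here refl)
    impossible (no _)     (yes refl) _ = adj-irrefl G refl ip
    impossible (no _)     (no _)     t with known Φ (i ≁ j) in eq
    ... | true = known-sound d {φ = i ≁ j} (subst T (sym eq) _) hs ip

  tailed-solved : Solved d tailed
  tailed-solved G deg vs uvs hs@(_ ∷ _ ∷ _ ∷ _ ∷ _ ∷ _ ∷ _ ∷ _ ∷ _ ∷ heavy-e ∷ [])
    with outer-neighbour deg hs 0F 4F heavy-e
  ... | p , ep , p∉ = use-one-more d tailed deg uvs hs (0F ~ 5F ∷ [])
    (certified d solved₅ _
      (query 0F 1F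
       (reach to-butterfly (1F ∷ 0F ∷ 5F ∷ 2F ∷ 3F ∷ []))
       (query 0F 2F
        (query 0F 3F
         (reach to-butterfly (2F ∷ 0F ∷ 3F ∷ 1F ∷ 4F ∷ []))
         (query 0F 4F
          (reach to-butterfly (2F ∷ 0F ∷ 4F ∷ 1F ∷ 3F ∷ []))
          (query 3F 4F
           (switch 0F 5F 1F 3F (reach to-butterfly (2F ∷ 0F ∷ 1F ∷ 3F ∷ 4F ∷ [])))
           (switch 0F 5F 1F 2F (reach to-K₂,₄ (1F ∷ 2F ∷ 0F ∷ 3F ∷ 4F ∷ 5F ∷ []))))))
        (switch 0F 5F 2F 3F (reach to-butterfly (1F ∷ 2F ∷ 4F ∷ 3F ∷ 5F ∷ []))))))
    p∉ (adj-sym G ep ∷ [])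

  -- If `4F` is adjacent to an end of the path, there is a butterfly. If it is adjacent to the
  -- middle `1F`, then `2F`, `3F` and `4F` become pages on the spine from `0F` to `1F`. Otherwise
  -- the pattern is `tailed`.
  path-solved : Solved d path
  path-solved = certified d (++⁺ solved₅ (tailed-solved ∷ [])) _
    (query 2F 4F
     (reach to-butterfly (0F ∷ 1F ∷ 3F ∷ 2F ∷ 4F ∷ []))
     (query 3F 4F
      (reach to-butterfly (0F ∷ 1F ∷ 2F ∷ 3F ∷ 4F ∷ []))
      (query 1F 4F
       (query 2F 3F
        (reach to-butterfly (0F ∷ 1F ∷ 4F ∷ 2F ∷ 3F ∷ []))
        (reach to-book (0F ∷ 1F ∷ 2F ∷ 3F ∷ 4F ∷ [])))
       (reach to-tailed (0F ∷ 1F ∷ 2F ∷ 3F ∷ 4F ∷ [])))))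

  -- This is where the cycles come from. A common outer neighbour of `3F` and `4F` closes a 4-cycle
  -- through the centre; two adjacent ones close a 5-cycle, or a 4-cycle if one of them serves both.
  -- If they are nonadjacent, a switch joins them and at the same time the two loose vertices.
  loose-solved : Solved d loose
  loose-solved G deg vs uvs hs@(_ ∷ _ ∷ _ ∷ _ ∷ _ ∷ _ ∷ _ ∷ _ ∷ _ ∷ _ ∷ heavy-c ∷ heavy-e ∷ [])
    with outer-neighbour deg hs 0F 3F heavy-c | outer-neighbour deg hs 0F 4F heavy-e
  ... | p , cp , p∉ | q , eq , q∉ with q ≟ p
  ... | yes refl = use-one-more d loose deg uvs hs (0F ~ 4F ∷ 0F ~ 5F ∷ [])
    (certified d solved₅ _
      (query 0F 1F
       (reach to-butterfly (1F ∷ 0F ∷ 4F ∷ 2F ∷ 3F ∷ []))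
       (query 0F 2F
        (switch 0F 2F 1F 4F (reach to-butterfly (1F ∷ 0F ∷ 5F ∷ 2F ∷ 3F ∷ [])))
        (query 0F 3F
         (switch 0F 3F 1F 4F (reach to-butterfly (1F ∷ 0F ∷ 5F ∷ 2F ∷ 3F ∷ [])))
         (reach to-C₃·C₄ (1F ∷ 2F ∷ 3F ∷ 4F ∷ 5F ∷ 0F ∷ []))))))
    p∉ (adj-sym G cp ∷ adj-sym G eq ∷ [])
  ... | no q≢p = use-two-more d loose deg uvs hs (0F ~ 4F ∷ []) (0F ~ 6F ∷ [])
    (certified d solved₅ _
      (query 0F 1F
       (query 0F 2F
        (reach to-butterfly (2F ∷ 0F ∷ 6F ∷ 3F ∷ 4F ∷ []))
        (query 1F 2F
         (reach to-butterfly (2F ∷ 1F ∷ 5F ∷ 3F ∷ 4F ∷ []))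
         (query 0F 3F
          (switch 0F 3F 2F 5F (reach to-butterfly (2F ∷ 0F ∷ 6F ∷ 3F ∷ 4F ∷ [])))
          (query 1F 3F
           (switch 1F 3F 2F 6F (reach to-butterfly (2F ∷ 1F ∷ 5F ∷ 3F ∷ 4F ∷ [])))
           (query 0F 4F
            (switch 0F 4F 2F 5F (reach to-butterfly (2F ∷ 0F ∷ 6F ∷ 3F ∷ 4F ∷ [])))
            (query 1F 4F
             (switch 1F 4F 2F 6F (reach to-butterfly (2F ∷ 1F ∷ 5F ∷ 3F ∷ 4F ∷ [])))
             (query 0F 5F
              (reach to-C₃·C₄ (2F ∷ 3F ∷ 4F ∷ 5F ∷ 6F ∷ 0F ∷ []))
              (query 1F 6F
               (reach to-C₃·C₄ (2F ∷ 3F ∷ 4F ∷ 5F ∷ 6F ∷ 1F ∷ []))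
               (reach to-C₃·C₅ (2F ∷ 3F ∷ 4F ∷ 5F ∷ 6F ∷ 1F ∷ 0F ∷ []))))))))))
       (switch 0F 6F 1F 5F (reach to-butterfly (2F ∷ 3F ∷ 4F ∷ 5F ∷ 6F ∷ [])))))
    p∉ q∉ q≢p (adj-sym G cp ∷ []) (adj-sym G eq ∷ [])

  edge-solved : Solved d edge
  edge-solved = certified d (++⁺ solved₅ (tailed-solved ∷ path-solved ∷ loose-solved ∷ [])) _
    (query 1F 3F
     (reach to-path (0F ∷ 1F ∷ 2F ∷ 3F ∷ 4F ∷ []))
     (query 2F 3F
      (reach to-path (0F ∷ 2F ∷ 1F ∷ 3F ∷ 4F ∷ []))
      (query 1F 4F
       (reach to-path (0F ∷ 1F ∷ 2F ∷ 4F ∷ 3F ∷ []))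
       (query 2F 4F
        (reach to-path (0F ∷ 2F ∷ 1F ∷ 4F ∷ 3F ∷ []))
        (query 3F 4F
         (reach to-butterfly (0F ∷ 1F ∷ 2F ∷ 3F ∷ 4F ∷ []))
         (reach to-loose (0F ∷ 1F ∷ 2F ∷ 3F ∷ 4F ∷ [])))))))

  solved₉ : All (Solved d) (butterfly ∷ K₂,₄ ∷ book ∷ C₃·C₄ ∷ C₃·C₅ ∷ tailed ∷ path ∷ loose ∷ edge ∷ [])
  solved₉ = ++⁺ solved₅ (tailed-solved ∷ path-solved ∷ loose-solved ∷ edge-solved ∷ [])

  -- If the outer vertices `0F` and `1F` are nonadjacent, one switch joins them and also `3F` with
  -- `4F`. If they are adjacent, one of them is, or is brought, next to the centre `2F` and forms a
  -- triangle there.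
  two-neighbours : Solved d (one-more (one-more independent₄ (0F ~ 2F ∷ [])) (0F ~ 4F ∷ []))
  two-neighbours = certified d solved₉ _
    (query 0F 1F
     (query 0F 2F
      (reach to-edge (2F ∷ 0F ∷ 4F ∷ 3F ∷ 5F ∷ []))
      (query 1F 2F
       (reach to-edge (2F ∷ 1F ∷ 3F ∷ 4F ∷ 5F ∷ []))
       (query 0F 3F
        (switch 0F 3F 2F 5F (reach to-edge (2F ∷ 0F ∷ 4F ∷ 3F ∷ 6F ∷ [])))
        (query 1F 4F
         (switch 0F 1F 3F 2F (reach to-edge (2F ∷ 1F ∷ 4F ∷ 5F ∷ 6F ∷ [])))
         (query 0F 5F
          (switch 0F 1F 2F 4F (reach to-edge (2F ∷ 0F ∷ 5F ∷ 3F ∷ 6F ∷ [])))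
          (switch 0F 1F 5F 2F (reach to-edge (2F ∷ 1F ∷ 3F ∷ 4F ∷ 6F ∷ []))))))))
     (switch 0F 4F 1F 3F (reach to-edge (2F ∷ 3F ∷ 4F ∷ 5F ∷ 6F ∷ []))))

  -- Comparing three of the outer neighbours with the first one is enough: any difference is a case
  -- of `two-neighbours`. If all coincide, they are a second common neighbour of the four, which
  -- gives `K₂,₄` unless it is adjacent to the centre.
  independent₄-solved : Solved d independent₄
  independent₄-solved G deg vs uvs
    hs@(_ ∷ _ ∷ _ ∷ _ ∷ _ ∷ _ ∷ _ ∷ _ ∷ _ ∷ _ ∷ heavy-a ∷ heavy-b ∷ heavy-c ∷ heavy-e ∷ [])
    with outer-neighbour deg hs 0F 1F heavy-a | outer-neighbour deg hs 0F 2F heavy-b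
       | outer-neighbour deg hs 0F 3F heavy-c | outer-neighbour deg hs 0F 4F heavy-e
  ... | p , ap , p∉ | q , bq , q∉ | r , cr , r∉ | s , es , s∉ with q ≟ p | r ≟ p | s ≟ p
  ... | yes refl | yes refl | yes refl = use-one-more d independent₄ deg uvs hs
    (0F ~ 2F ∷ 0F ~ 3F ∷ 0F ~ 4F ∷ 0F ~ 5F ∷ [])
    (certified d solved₉ _
      (query 0F 1F
       (reach to-edge (0F ∷ 1F ∷ 2F ∷ 3F ∷ 4F ∷ []))
       (reach to-K₂,₄ (0F ∷ 1F ∷ 2F ∷ 3F ∷ 4F ∷ 5F ∷ []))))
    p∉ (adj-sym G ap ∷ adj-sym G bq ∷ adj-sym G cr ∷ adj-sym G es ∷ [])
  ... | no q≢p | _ | _ = use-two-more d independent₄ deg uvs hs (0F ~ 2F ∷ []) (0F ~ 4F ∷ [])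
    two-neighbours
    p∉ q∉ q≢p (adj-sym G ap ∷ []) (adj-sym G bq ∷ [])
  ... | _ | no r≢p | _ = use-two-more d independent₄ deg uvs hs (0F ~ 2F ∷ []) (0F ~ 5F ∷ [])
    (certified d (two-neighbours ∷ []) _ (reach (here refl) (0F ∷ 1F ∷ 2F ∷ 3F ∷ 5F ∷ 4F ∷ 6F ∷ [])))
    p∉ r∉ r≢p (adj-sym G ap ∷ []) (adj-sym G cr ∷ [])
  ... | _ | _ | no s≢p = use-two-more d independent₄ deg uvs hs (0F ~ 2F ∷ []) (0F ~ 6F ∷ [])
    (certified d (two-neighbours ∷ []) _ (reach (here refl) (0F ∷ 1F ∷ 2F ∷ 3F ∷ 6F ∷ 4F ∷ 5F ∷ [])))
    p∉ s∉ s≢p (adj-sym G ap ∷ []) (adj-sym G es ∷ [])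

  star₄-solved : Solved d star₄
  star₄-solved = certified d (++⁺ solved₉ (independent₄-solved ∷ [])) _
    (query 1F 2F
     (reach to-edge (0F ∷ 1F ∷ 2F ∷ 3F ∷ 4F ∷ []))
     (query 1F 3F
      (reach to-edge (0F ∷ 1F ∷ 3F ∷ 2F ∷ 4F ∷ []))
      (query 2F 3F
       (reach to-edge (0F ∷ 2F ∷ 3F ∷ 1F ∷ 4F ∷ []))
       (query 1F 4F
        (reach to-edge (0F ∷ 1F ∷ 4F ∷ 2F ∷ 3F ∷ []))
        (query 2F 4F
         (reach to-edge (0F ∷ 2F ∷ 4F ∷ 1F ∷ 3F ∷ []))
         (query 3F 4F
          (reach to-edge (0F ∷ 3F ∷ 4F ∷ 1F ∷ 2F ∷ []))
          (reach to-independent₄ (0F ∷ 1F ∷ 2F ∷ 3F ∷ 4F ∷ []))))))))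

-- Four neighbours of degree at least two

module _ {n} {d : Fin n → ℕ} (U : Unexceptional d) {v : Fin n} (4≤dv : 4 ≤ d v)
         {ys : List (Fin n)} (uys : Unique ys) (4≤ys : 4 ≤ length ys) (v∉ys : v ∉ ys)
         (heavy-ys : All (λ y → 2 ≤ d y) ys) where

  open Solutions U

  -- If v has a leaf x as a neighbour and misses y, then switching vx and yz
  -- for a further neighbour z of y brings y into the neighbourhood of v.
  gather : ∀ m {G} → degree G ≗ d → ∀ {xs} → Unique xs → All (Adj G v) xs → All (λ x → 2 ≤ d x) xs →
           length xs + m ≡ 4 → Good d
  gather zero {G} deg {a ∷ b ∷ c ∷ e ∷ []}
    ((a≢b ∷ a≢c ∷ a≢e ∷ []) ∷ (b≢c ∷ b≢e ∷ []) ∷ (c≢e ∷ []) ∷ [] ∷ [])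
    (va ∷ vb ∷ vc ∷ ve ∷ []) (ha ∷ hb ∷ hc ∷ he ∷ []) refl =
    star₄-solved G deg (v ∷ a ∷ b ∷ c ∷ e ∷ [])
      ((≢ va ∷ ≢ vb ∷ ≢ vc ∷ ≢ ve ∷ []) ∷
       (a≢b ∷ a≢c ∷ a≢e ∷ []) ∷
       (b≢c ∷ b≢e ∷ []) ∷
       (c≢e ∷ []) ∷ [] ∷ [])
      (va ∷ vb ∷ vc ∷ ve ∷ ha ∷ hb ∷ hc ∷ he ∷ [])
    where
    ≢ : ∀ {x} → Adj G v x → v ≢ x
    ≢ vx v≡x = adj-irrefl G v≡x vx
  gather (suc m) {G} deg {xs} uxs vxs hxs len with any? (λ y → ¬? (_∈?_ _≟_ y xs)) ys
  ... | no all∈ = contradiction (unique-length uys (λ {y} y∈ys → decided y∈ys)) (<⇒≱ (<-≤-trans len<4 4≤ys))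
    where
    len<4 : length xs < 4
    len<4 = subst (length xs <_) len (m<m+n (length xs) z<s)
    decided : ∀ {y} → y ∈ ys → y ∈ xs
    decided {y} y∈ys with _∈?_ _≟_ y xs
    ... | yes y∈xs = y∈xs
    ... | no y∉xs  = contradiction (lose y∈ys y∉xs) all∈
  ... | yes found with find found
  ... | y , y∈ys , y∉xs with adj? G v y
  ... | yes vy = gather m {G} deg (AllP.¬Any⇒All¬ xs y∉xs ∷ uxs) (vy ∷ vxs) (All.lookup heavy-ys y∈ys ∷ hxs)
                   (trans (sym (+-suc (length xs) m)) len)
  ... | no ¬vy with further-neighbour G {v} uxs (<-≤-trans (subst (length xs <_) len (m<m+n (length xs) z<s))
                                                       (subst (4 ≤_) (sym (deg v)) 4≤dv))
  ... | x , vx , x∉xs with 2 ≤? d x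
  ... | yes hx = gather m {G} deg (AllP.¬Any⇒All¬ xs x∉xs ∷ uxs) (vx ∷ vxs) (hx ∷ hxs) (trans (sym (+-suc (length xs) m)) len)
  ... | no ¬hx with further-neighbour G {y} {x ∷ []} ([] ∷ []) (subst (2 ≤_) (sym (deg y)) (All.lookup heavy-ys y∈ys))
  ... | z , yz , z∉ =
    gather m {graph} (λ u → trans (degrees u) (deg u)) (AllP.¬Any⇒All¬ xs y∉xs ∷ uxs)
      (known-sound d {φ = 0F ~ 2F} _ holds ∷ All.zipWith kept (vxs , AllP.¬Any⇒All¬ xs x∉xs))
      (All.lookup heavy-ys y∈ys ∷ hxs) (trans (sym (+-suc (length xs) m)) len)
    where
    v≢x : v ≢ x
    v≢x eq = adj-irrefl G eq vx
    v≢y : v ≢ y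
    v≢y refl = v∉ys y∈ys
    v≢z : v ≢ z
    v≢z refl = ¬vy (adj-sym G yz)
    x≢y : x ≢ y
    x≢y refl = ¬vy vx
    x≢z : x ≢ z
    x≢z x≡z = z∉ (here (sym x≡z))
    y≢z : y ≢ z
    y≢z eq = adj-irrefl G eq yz
    -- The light vertex `x` has no neighbour besides `v`, so the new edge `xz` is free for the
    -- switch.
    ¬xz : ¬ Adj G x z
    ¬xz xz = ¬hx (subst (2 ≤_) (deg x) (neighbours≤degree G {x} {v ∷ z ∷ []} ((v≢z ∷ []) ∷ [] ∷ []) (adj-sym G vx ∷ xz ∷ [])))
    open Switched (switch-graph d {vs = v ∷ x ∷ y ∷ z ∷ []}
      ((v≢x ∷ v≢y ∷ v≢z ∷ []) ∷ (x≢y ∷ x≢z ∷ []) ∷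
       (y≢z ∷ []) ∷ [] ∷ [])
      G (0F ~ 1F ∷ 2F ~ 3F ∷ 0F ≁ 2F ∷ 1F ≁ 3F ∷ []) 0F 1F 2F 3F _ (vx ∷ yz ∷ ¬vy ∷ ¬xz ∷ []))
    kept : ∀ {u} → Adj G v u × x ≢ u → Adj graph v u
    kept (vu , x≢u) = keeps (λ { (inj₁ (_ , x≡u)) → x≢u x≡u ; (inj₂ (_ , x≡v)) → v≢x (sym x≡v) })
                            (λ { (inj₁ (y≡v , _)) → v≢y (sym y≡v) ; (inj₂ (_ , z≡v)) → v≢z (sym z≡v) }) vu

  good : ∀ {G} → degree G ≗ d → Good d
  good {G} deg = gather 4 {G} deg {[]} [] [] [] refl

-- Degree sequences

Descending : List ℕ → Set
Descending = Linked _≥_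

toList-descending : ∀ {n} {π : Vec ℕ n} → NonIncreasing π → Descending (toList π)
toList-descending []        = []
toList-descending [-]       = [-]
toList-descending {π = _ ∷ _ ∷ _} (x≥y ∷ l) = x≥y ∷ toList-descending l

-- Translates the multiset conditions of `Unexceptional` into the equations between sequences of the
-- theorem: a sorted list is determined by its multiset.
descending-↭ : ∀ {xs ys} → Descending xs → Descending ys → xs ↭ ys → xs ≡ ys
descending-↭ dxs dys xs↭ys = ≋⇒≡ (↗↭↗⇒≋ ≥-totalOrder dxs dys (↭⇒↭ₛ xs↭ys))

descending-replicate : ∀ {c ys} k → Descending (c ∷ ys) → Descending (c ∷ replicate k c ++ ys)
descending-replicate zero    l = l
descending-replicate (suc k) l = ≤-refl ∷ descending-replicate k l

descending-constant : ∀ {c x} k → c ≤ x → Descending (x ∷ replicate k c)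
descending-constant zero    _   = [-]
descending-constant (suc k) c≤x = c≤x ∷ descending-constant k ≤-refl

descending-twos-ones : ∀ {x} i j → 2 ≤ x → Descending (x ∷ replicate i 2 ++ replicate j 1)
descending-twos-ones zero    j 2≤x = descending-constant j (<⇒≤ 2≤x)
descending-twos-ones (suc i) j 2≤x = 2≤x ∷ descending-replicate i (descending-constant j (s≤s z≤n))

lookup-antitone : ∀ {n} {π : Vec ℕ n} → NonIncreasing π → ∀ {i j} → toℕ i ≤ toℕ j → lookup π j ≤ lookup π i
lookup-antitone {π = π} l i≤j with m≤n⇒m<n∨m≡n i≤j
... | inj₁ i<j = lookup⁺ (λ x≥y y≥z → ≤-trans y≥z x≥y) l i<j
... | inj₂ i≡j = ≤-reflexive (cong (lookup π) (sym (toℕ-injective i≡j)))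

module _ {n} (ρ : Permutation n n) where

  permuted-injective : ∀ {i j} → ρ ⟨$⟩ʳ i ≡ ρ ⟨$⟩ʳ j → i ≡ j
  permuted-injective eq = trans (sym (inverseˡ ρ)) (trans (cong (ρ ⟨$⟩ˡ_) eq) (inverseˡ ρ))

  -- The image list is duplicate-free and as long as `allFin n`, so nothing can be left over when it
  -- is extracted.
  allFin-permuted : allFin n ↭ map (ρ ⟨$⟩ʳ_) (allFin n)
  allFin-permuted with extract (UniqueP.map⁺ permuted-injective (UniqueP.allFin⁺ n)) (λ {x} _ → ∈-allFin x)
  ... | []     , p = ↭-trans p (↭-reflexive (++-identityʳ _))
  ... | r ∷ rs , p = contradiction (trans (sym (length-tabulate id)) (complement-length-map p)) (m≢1+m+n n)
    where
    complement-length-map : allFin n ↭ map (ρ ⟨$⟩ʳ_) (allFin n) ++ r ∷ rs → length (allFin n) ≡ suc (n + length rs)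
    complement-length-map p = begin
      length (allFin n)                                        ≡⟨ Perm.↭-length p ⟩
      length (map (ρ ⟨$⟩ʳ_) (allFin n) ++ r ∷ rs)              ≡⟨ length-++ (map (ρ ⟨$⟩ʳ_) (allFin n)) ⟩
      length (map (ρ ⟨$⟩ʳ_) (allFin n)) + suc (length rs)
        ≡⟨ cong (_+ suc (length rs)) (trans (length-map _ (allFin n)) (length-tabulate id)) ⟩
      n + suc (length rs)                                      ≡⟨ +-suc n (length rs) ⟩
      suc (n + length rs)                                      ∎
      where open ≡-Reasoning

realized-degrees : ∀ {n} {π : Vec ℕ n} {G} → G Realizes π → toList π ↭ map (degree G) (allFin n)
realized-degrees {n} {π} {G} (ρ , eq) = ↭-trans (↭-reflexive (toList-lookup π))
  (↭-trans (Perm.map⁺ (lookup π) (allFin-permuted ρ))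
           (↭-reflexive (trans (sym (map-∘ (allFin n))) (map-cong eq (allFin n)))))

-- Sufficiency for degree sequences

module _ {n} (5≤n : 5 ≤ n) {π : Vec ℕ n} (π↘ : NonIncreasing π) where

  Conditions : Set
  Conditions =
      lookup π (inject≤ 0F 5≤n) ≥ 4
    × lookup π (inject≤ 4F 5≤n) ≥ 2
    × (n ≥ 6 → toList π ≢ replicate 2 (n ∸ 2) ++ replicate (n ∸ 2) 2)
    × (∀ k i → 1 ≤ k → k ≤ (n ∸ 1) / 2 ∸ 1 → 3 ≤ i → i ≤ n ∸ 2 * k →
         toList π ≢ (n ∸ k) ∷ (k + i) ∷ replicate i 2 ++ replicate (n ∸ i ∸ 2) 1)
    × (n ≡ 6 → toList π ≢ 4 ∷ replicate 5 2)
    × (n ≡ 7 → toList π ≢ 4 ∷ replicate 6 2)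

  -- Makes the excluded sequence nonincreasing. As `3 ≤ i`, the bound `n ∸ 2 * k` is nonzero, so its
  -- subtraction is not truncated.
  k+i≤n∸k : ∀ {k i} → 3 ≤ i → i ≤ n ∸ 2 * k → k + i ≤ n ∸ k
  k+i≤n∸k {k} {i} 3≤i i≤ = m+n≤o⇒m≤o∸n (k + i) (begin
    k + i + k      ≡⟨ rearrange k i ⟩
    i + 2 * k      ≤⟨ m≤n∸o⇒m+o≤n′ ⟩
    n              ∎)
    where
    open ≤-Reasoning
    rearrange : ∀ k i → k + i + k ≡ i + 2 * k
    rearrange = solve-∀
    2k≤n : 2 * k ≤ n
    2k≤n = <⇒≤ (m∸n≢0⇒n<m (λ eq → contradiction (≤-trans 3≤i (subst (i ≤_) eq i≤)) λ ()))
    m≤n∸o⇒m+o≤n′ : i + 2 * k ≤ n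
    m≤n∸o⇒m+o≤n′ = subst (i + 2 * k ≤_) (m∸n+n≡m 2k≤n) (+-monoˡ-≤ (2 * k) i≤)

  sufficient : VecAll.All (_> 0) π → Graphic π → Conditions → Potentially K₅-C₄ -Graphic π
  sufficient π>0 (G , ρ , eq) (c₁ , c₂ , c₃ , c₄ , c₅ , c₆) =
    let realized G′ deg′ K⊑G′ = good U 4≤dv uys ≤-refl v∉ys heavy-ys {G} (λ _ → refl)
    -- The same `ρ` serves, because switches preserve the degree of every single vertex.
    in  G′ , (ρ , λ i → trans (eq i) (sym (deg′ i))) , K⊑G′
    where
    d : Fin n → ℕ
    d = degree G
    terms : toList π ↭ map d (allFin n)
    terms = realized-degrees {G = G} (ρ , eq)
    sorted-terms : ∀ {xs} → Descending xs → map d (allFin n) ↭ xs → toList π ≡ xs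
    sorted-terms xs↘ p = descending-↭ (toList-descending π↘) xs↘ (↭-trans terms p)
    U : Unexceptional d
    U = record
      { positive  = λ u → subst (0 <_) (eq u) (VecAllP.lookup⁺ π>0 (ρ ⟨$⟩ʳ u))
      ; not-K₂,ₘ  = λ n≥6 p → c₃ n≥6 (sorted-terms
          (descending-replicate 1 (descending-constant (n ∸ 2) (∸-monoˡ-≤ 2 (≤-trans (s≤s (s≤s (s≤s (s≤s z≤n)))) n≥6)))) p)
      ; not-book  = λ k i 1≤k k≤ 3≤i i≤ p → c₄ k i 1≤k k≤ 3≤i i≤ (sorted-terms
          (k+i≤n∸k {k} 3≤i i≤ ∷ descending-twos-ones i _ (≤-trans (≤-trans (s≤s (s≤s z≤n)) 3≤i) (m≤n+m i k))) p)
      ; not-six   = λ n≡6 p → c₅ n≡6 (sorted-terms (descending-constant 5 (s≤s (s≤s z≤n))) p)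
      ; not-seven = λ n≡7 p → c₆ n≡7 (sorted-terms (descending-constant 6 (s≤s (s≤s z≤n))) p)
      }
    -- `at j` is the vertex carrying term `j`. Term 0 provides the prospective centre; the next four
    -- are heavy because the last of them is the smallest.
    at : Fin 5 → Fin n
    at j = ρ ⟨$⟩ˡ inject≤ j 5≤n
    at-degree : ∀ j → d (at j) ≡ lookup π (inject≤ j 5≤n)
    at-degree j = trans (sym (eq (at j))) (cong (lookup π) (inverseʳ ρ))
    at-injective : ∀ {i j} → at i ≡ at j → i ≡ j
    at-injective e = inject≤-injective 5≤n 5≤n _ _ (trans (sym (inverseʳ ρ)) (trans (cong (ρ ⟨$⟩ʳ_) e) (inverseʳ ρ)))
    uys : Unique (map at (1F ∷ 2F ∷ 3F ∷ 4F ∷ []))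
    uys = UniqueP.map⁺ at-injective (((λ ()) ∷ (λ ()) ∷ (λ ()) ∷ []) ∷ ((λ ()) ∷ (λ ()) ∷ []) ∷ ((λ ()) ∷ []) ∷ [] ∷ [])
    4≤dv : 4 ≤ d (at 0F)
    4≤dv = subst (4 ≤_) (sym (at-degree 0F)) c₁
    v∉ys : at 0F ∉ map at (1F ∷ 2F ∷ 3F ∷ 4F ∷ [])
    v∉ys (here e) with () ← at-injective e
    v∉ys (there (here e)) with () ← at-injective e
    v∉ys (there (there (here e))) with () ← at-injective e
    v∉ys (there (there (there (here e)))) with () ← at-injective e
    at-heavy : ∀ j → toℕ j ≤ 4 → 2 ≤ d (at j)
    at-heavy j j≤4 = subst (2 ≤_) (sym (at-degree j)) (≤-trans c₂ (lookup-antitone π↘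
      (subst₂ _≤_ (sym (toℕ-inject≤ j 5≤n)) (sym (toℕ-inject≤ 4F 5≤n)) j≤4)))
    heavy-ys : All (λ y → 2 ≤ d y) (map at (1F ∷ 2F ∷ 3F ∷ 4F ∷ []))
    heavy-ys = at-heavy 1F (s≤s z≤n) ∷ at-heavy 2F (s≤s (s≤s z≤n)) ∷ at-heavy 3F (s≤s (s≤s (s≤s z≤n)))
             ∷ at-heavy 4F ≤-refl ∷ []

-- Necessity

record Butterfly {n} (G : Graph n) : Set where
  constructor butterfly-at
  field
    {x a b c e} : Fin n
    distinct    : Unique (x ∷ a ∷ b ∷ c ∷ e ∷ [])
    xa : Adj G x a
    xb : Adj G x b
    xc : Adj G x c
    xe : Adj G x e
    ab : Adj G a b
    ce : Adj G c e

⊑⇒Butterfly : ∀ {n} {G : Graph n} → K₅-C₄ ⊑ G → Butterfly G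
⊑⇒Butterfly {n} (f , inj , hom) = butterfly-at
  (UniqueP.map⁺ inj {xs = 4F ∷ 0F ∷ 2F ∷ 1F ∷ 3F ∷ []}
    ( ((λ ()) ∷ (λ ()) ∷ (λ ()) ∷ (λ ()) ∷ []) ∷ ((λ ()) ∷ (λ ()) ∷ (λ ()) ∷ []) ∷ ((λ ()) ∷ (λ ()) ∷ [])
    ∷ ((λ ()) ∷ []) ∷ [] ∷ []))
  (hom (from-yes (adj? K₅-C₄ 4F 0F))) (hom (from-yes (adj? K₅-C₄ 4F 2F)))
  (hom (from-yes (adj? K₅-C₄ 4F 1F))) (hom (from-yes (adj? K₅-C₄ 4F 3F)))
  (hom (from-yes (adj? K₅-C₄ 0F 2F))) (hom (from-yes (adj? K₅-C₄ 1F 3F)))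

module _ {n} (G : Graph n) where

  private
    _∈?ᶠ_ : ∀ (u : Fin n) us → Dec (u ∈ us)
    _∈?ᶠ_ = _∈?_ _≟_

  -- A vertex cover contains an end of `ab` and an end of `ce`. With the centre these are three
  -- vertices; without it all four outer vertices are needed.
  edge-avoiding : Butterfly G → ∀ v w → ∃₂ λ s t → Adj G s t × s ∉ v ∷ w ∷ [] × t ∉ v ∷ w ∷ []
  edge-avoiding (butterfly-at {x} {a} {b} {c} {e}
    ((x≢a ∷ x≢b ∷ x≢c ∷ x≢e ∷ []) ∷ (a≢b ∷ a≢c ∷ a≢e ∷ []) ∷ (b≢c ∷ b≢e ∷ []) ∷ (c≢e ∷ []) ∷ [] ∷ [])
    xa xb xc xe ab ce) v w = go (x ∈?ᶠ S) (a ∈?ᶠ S) (b ∈?ᶠ S) (c ∈?ᶠ S) (e ∈?ᶠ S)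
    where
    S : List (Fin n)
    S = v ∷ w ∷ []
    three : ∀ {p q r} → p ≢ q → p ≢ r → q ≢ r → p ∈ S → q ∈ S → r ∈ S → ⊥
    three p≢q p≢r q≢r p∈ q∈ r∈ = contradiction
      (unique-length ((p≢q ∷ p≢r ∷ []) ∷ (q≢r ∷ []) ∷ [] ∷ [])
        (λ { (here refl) → p∈ ; (there (here refl)) → q∈ ; (there (there (here refl))) → r∈ }))
      (λ { (s≤s (s≤s ())) })
    go : Dec (x ∈ S) → Dec (a ∈ S) → Dec (b ∈ S) → Dec (c ∈ S) → Dec (e ∈ S) → ∃₂ λ s t → Adj G s t × s ∉ S × t ∉ S
    go _        (no a∉)  (no b∉)  _        _        = a , b , ab , a∉ , b∉
    go _        _        _        (no c∉)  (no e∉)  = c , e , ce , c∉ , e∉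
    go (no x∉)  (no a∉)  _        _        _        = x , a , xa , x∉ , a∉
    go (no x∉)  _        (no b∉)  _        _        = x , b , xb , x∉ , b∉
    go _        (yes a∈) (yes b∈) (yes c∈) _        = ⊥-elim (three a≢b a≢c b≢c a∈ b∈ c∈)
    go _        (yes a∈) (yes b∈) _        (yes e∈) = ⊥-elim (three a≢b a≢e b≢e a∈ b∈ e∈)
    go (yes x∈) (yes a∈) (no _)   (yes c∈) _        = ⊥-elim (three x≢a x≢c a≢c x∈ a∈ c∈)
    go (yes x∈) (yes a∈) (no _)   _        (yes e∈) = ⊥-elim (three x≢a x≢e a≢e x∈ a∈ e∈)
    go (yes x∈) (no _)   (yes b∈) (yes c∈) _        = ⊥-elim (three x≢b x≢c b≢c x∈ b∈ c∈)
    go (yes x∈) (no _)   (yes b∈) _        (yes e∈) = ⊥-elim (three x≢b x≢e b≢e x∈ b∈ e∈)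

  -- The sum of degrees counts twice the edges at v or w, of which there are at
  -- least d v + d w − 1, and one further edge.
  two-degrees-bound : ∀ {v w s t} → v ≢ w → Adj G s t → s ∉ v ∷ w ∷ [] → t ∉ v ∷ w ∷ [] →
                      2 * (degree G v + degree G w) ≤ ∑ (degree G) (allFin n)
  two-degrees-bound {v} {w} {s} {t} v≢w st s∉ t∉ = begin
    2 * D                                          ≡⟨ cong (D +_) (+-identityʳ D) ⟩
    D + D                                          ≤⟨ +-monoʳ-≤ D D≤ ⟩
    D + ((row′ s + 1) + (row′ t + 1) + ∑ row′ R)
      ≤⟨ +-monoʳ-≤ D (+-mono-≤ (+-mono-≤ s-bound t-bound) (∑-mono degree-bound R)) ⟩
    D + (degree G s + degree G t + ∑ (degree G) R)
      ≡⟨ collect (degree G v) (degree G w) (degree G s) (degree G t) (∑ (degree G) R) ⟩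
    ∑ (degree G) (v ∷ w ∷ s ∷ t ∷ []) + ∑ (degree G) R
                                                   ≡⟨ ∑-complement (degree G) (v ∷ w ∷ s ∷ t ∷ []) p ⟨
    ∑ (degree G) (allFin n)                        ∎
    where
    open ≤-Reasoning
    D : ℕ
    D = degree G v + degree G w
    row′ : Fin n → ℕ
    row′ y = row G v y + row G w y
    s≢t : s ≢ t
    s≢t eq = adj-irrefl G eq st
    split : ∃ λ rs → allFin n ↭ (v ∷ w ∷ s ∷ t ∷ []) ++ rs × All (_∉ (v ∷ w ∷ s ∷ t ∷ [])) rs
    split = complement
      ( (v≢w ∷ (λ { refl → s∉ (here refl) }) ∷ (λ { refl → t∉ (here refl) }) ∷ [])
      ∷ ((λ { refl → s∉ (there (here refl)) }) ∷ (λ { refl → t∉ (there (here refl)) }) ∷ [])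
      ∷ (s≢t ∷ []) ∷ [] ∷ [])
    R : List (Fin n)
    R = proj₁ split
    p : allFin n ↭ (v ∷ w ∷ s ∷ t ∷ []) ++ R
    p = proj₁ (proj₂ split)
    collect : ∀ a b c d r → a + b + (c + d + r) ≡ a + (b + (c + (d + 0))) + r
    collect = solve-∀
    D≡ : D ≡ ∑ row′ (v ∷ w ∷ s ∷ t ∷ []) + ∑ row′ R
    D≡ = trans (cong₂ _+_ (degree-∑ G v) (degree-∑ G w))
           (trans (sym (∑-+ (row G v) (row G w) (allFin n))) (∑-complement row′ (v ∷ w ∷ s ∷ t ∷ []) p))
    -- The only possible edge between `v` and `w` is counted once from either end.
    small : row′ v + row′ w ≤ 2
    small = +-mono-≤ (subst (_≤ 1) (sym (cong (_+ row G w v) (row-self G v))) (bit≤1 _))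
                     (subst (_≤ 1) (sym (trans (cong (row G v w +_) (row-self G w)) (+-identityʳ _))) (bit≤1 _))
    D≤ : D ≤ (row′ s + 1) + (row′ t + 1) + ∑ row′ R
    D≤ = begin
      D                                                         ≡⟨ D≡ ⟩
      row′ v + (row′ w + (row′ s + (row′ t + 0))) + ∑ row′ R
        ≡⟨ gather-terms (row′ v) (row′ w) (row′ s) (row′ t) (∑ row′ R) ⟩
      (row′ v + row′ w) + (row′ s + row′ t + ∑ row′ R)          ≤⟨ +-monoˡ-≤ _ small ⟩
      2 + (row′ s + row′ t + ∑ row′ R)                          ≡⟨ spread (row′ s) (row′ t) (∑ row′ R) ⟩
      (row′ s + 1) + (row′ t + 1) + ∑ row′ R                    ∎
      where
      gather-terms : ∀ a b c d r → a + (b + (c + (d + 0))) + r ≡ (a + b) + (c + d + r)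
      gather-terms = solve-∀
      spread : ∀ c d r → 2 + (c + d + r) ≡ (c + 1) + (d + 1) + r
      spread = solve-∀
    degree-bound : ∀ y → row′ y ≤ degree G y
    degree-bound y =
      let _ , q , _ = complement {xs = v ∷ w ∷ []} ((v≢w ∷ []) ∷ [] ∷ [])
      in  subst (row′ y ≤_) (sym (degree-split G y (v ∷ w ∷ []) q))
            (≤-trans (≤-reflexive (cong₂ _+_ (row-sym G v y) (trans (row-sym G w y) (sym (+-identityʳ _))))) (m≤m+n _ _))
    -- The edge to `z` is one that `row′ y` does not count.
    strict-bound : ∀ {y z} → Adj G y z → z ∉ v ∷ w ∷ [] → row′ y + 1 ≤ degree G y
    strict-bound {y} {z} yz z∉ =
      let _ , q , _ = complement {xs = v ∷ w ∷ z ∷ []}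
            ((v≢w ∷ (λ { refl → z∉ (here refl) }) ∷ []) ∷ ((λ { refl → z∉ (there (here refl)) }) ∷ []) ∷ [] ∷ [])
      in  subst (row′ y + 1 ≤_) (sym (degree-split G y (v ∷ w ∷ z ∷ []) q))
            (≤-trans (≤-reflexive (trans (cong₂ (λ i j → i + j + 1) (row-sym G v y) (row-sym G w y))
              (trans (reassociate (row G y v) (row G y w))
                     (cong (λ i → row G y v + (row G y w + (i + 0))) (sym (row-adj G yz)))))) (m≤m+n _ _))
      where
      reassociate : ∀ a b → a + b + 1 ≡ a + (b + (1 + 0))
      reassociate = solve-∀
    s-bound : row′ s + 1 ≤ degree G s
    s-bound = strict-bound st t∉
    t-bound : row′ t + 1 ≤ degree G t
    t-bound = strict-bound (adj-sym G st) s∉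

  saturated : ∀ {x c e y} → Adj G c x → Adj G c e → x ≢ e → degree G c ≡ 2 → x ≢ y → e ≢ y → ¬ Adj G c y
  saturated cx ce x≢e dc x≢y e≢y cy = contradiction
    (subst (3 ≤_) dc (neighbours≤degree G ((x≢e ∷ x≢y ∷ []) ∷ (e≢y ∷ []) ∷ [] ∷ []) (cx ∷ ce ∷ cy ∷ [])))
    (λ { (s≤s (s≤s ())) })

  -- Both `c` and `e` have their two neighbours inside the triangle, so `y` misses them as well as
  -- itself.
  triangle-bound : ∀ {x c e y} → Adj G x c → Adj G x e → Adj G c e → x ≢ y → c ≢ y → e ≢ y →
                   degree G c ≡ 2 → degree G e ≡ 2 → 3 + degree G y ≤ n
  triangle-bound {x} {c} {e} {y} xc xe ce x≢y c≢y e≢y dc de =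
    nonneighbours+degree≤n G {y} {y ∷ c ∷ e ∷ []}
      (((λ y≡c → c≢y (sym y≡c)) ∷ (λ y≡e → e≢y (sym y≡e)) ∷ []) ∷ ((λ eq → adj-irrefl G eq ce) ∷ []) ∷ [] ∷ [])
      ( adj-irrefl G refl
      ∷ saturated (adj-sym G xc) ce (λ eq → adj-irrefl G eq xe) dc x≢y e≢y ∘ adj-sym G
      ∷ saturated (adj-sym G xe) (adj-sym G ce) (λ eq → adj-irrefl G eq xc) de x≢y c≢y ∘ adj-sym G
      ∷ [])

  centre-degree : (B : Butterfly G) → 4 ≤ degree G (Butterfly.x B)
  centre-degree (butterfly-at (_ ∷ u) xa xb xc xe _ _) = neighbours≤degree G u (xa ∷ xb ∷ xc ∷ xe ∷ [])

  butterfly-degrees : (B : Butterfly G) → let open Butterfly B in All (λ u → 2 ≤ degree G u) (x ∷ a ∷ b ∷ c ∷ e ∷ [])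
  butterfly-degrees B@(butterfly-at ((x≢a ∷ x≢b ∷ x≢c ∷ x≢e ∷ []) ∷ _) xa xb xc xe ab ce) =
      ≤-trans (s≤s (s≤s z≤n)) (centre-degree B)
    ∷ two (adj-sym G xa) ab x≢b ∷ two (adj-sym G xb) (adj-sym G ab) x≢a
    ∷ two (adj-sym G xc) ce x≢e ∷ two (adj-sym G xe) (adj-sym G ce) x≢c ∷ []
    where
    two : ∀ {u p q} → Adj G u p → Adj G u q → p ≢ q → 2 ≤ degree G u
    two up uq p≢q = neighbours≤degree G ((p≢q ∷ []) ∷ [] ∷ []) (up ∷ uq ∷ [])

  -- Degree at least four forces the centre to be `v` or `w`. The other one has degree `n ∸ 2`,
  -- which contradicts `triangle-bound`.
  spindle-butterfly-free : 6 ≤ n → ∀ {v w R} → allFin n ↭ v ∷ w ∷ R → degree G v ≡ n ∸ 2 → degree G w ≡ n ∸ 2 →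
                           All (λ u → degree G u ≡ 2) R → ¬ Butterfly G
  spindle-butterfly-free 6≤n {v} {w} {R} cover dv dw dR B@(butterfly-at {x} {a} {b} {c} {e} distinct xa xb xc xe ab ce)
    with ((x≢a ∷ x≢b ∷ x≢c ∷ x≢e ∷ []) ∷ (a≢b ∷ a≢c ∷ a≢e ∷ []) ∷ (b≢c ∷ b≢e ∷ []) ∷ (c≢e ∷ []) ∷ [] ∷ []) ← distinct =
    [ centre dw (≢-sym v≢w) (λ { (there (there u∈)) _ u≢v → All.lookup dR u∈
                               ; (here eq) _ u≢v → contradiction eq u≢v
                               ; (there (here eq)) u≢w _ → contradiction eq u≢w })
    , [ centre dv v≢w (λ { (there (there u∈)) _ _ → All.lookup dR u∈
                         ; (here eq) u≢v _ → contradiction eq u≢v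
                         ; (there (here eq)) _ u≢w → contradiction eq u≢w })
      , (λ x∈R → contradiction (subst (4 ≤_) (All.lookup dR x∈R) (centre-degree B)) (λ { (s≤s (s≤s ())) }))
      ]′ ]′ (position (member x))
    where
    member : ∀ u → u ∈ v ∷ w ∷ R
    member u = Perm.∈-resp-↭ cover (∈-allFin u)
    position : ∀ {u} → u ∈ v ∷ w ∷ R → u ≡ v ⊎ (u ≡ w ⊎ u ∈ R)
    position (here eq)          = inj₁ eq
    position (there (here eq))  = inj₂ (inj₁ eq)
    position (there (there u∈)) = inj₂ (inj₂ u∈)
    v≢w : v ≢ w
    v≢w with (v≢w ∷ _) ∷ _ ← PermSetoid.Unique-resp-↭ (setoid _) (↭⇒↭ₛ cover) (UniqueP.allFin⁺ n) = v≢w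
    centre : ∀ {z y} → degree G y ≡ n ∸ 2 → y ≢ z →
             (∀ {u} → u ∈ v ∷ w ∷ R → u ≢ y → u ≢ z → degree G u ≡ 2) → x ≡ z → ⊥
    centre {y = y} dy y≢z others refl = conclude (y ≟ c) (y ≟ e)
      where
      too-many : ¬ 3 + degree G y ≤ n
      too-many le = contradiction
        (subst (_≤ n) (trans (cong (3 +_) dy) (cong suc (m+[n∸m]≡n (≤-trans (s≤s (s≤s z≤n)) 6≤n)))) le)
                                  (<⇒≱ ≤-refl)
      two : ∀ {u} → u ≢ y → x ≢ u → degree G u ≡ 2
      two u≢y x≢u = others (member _) u≢y (≢-sym x≢u)
      conclude : Dec (y ≡ c) → Dec (y ≡ e) → ⊥
      -- At most one of the triangles contains `y`; the other consists of the centre and two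
      -- vertices of degree two.
      conclude (no y≢c) (no y≢e) = too-many (triangle-bound xc xe ce (≢-sym y≢z) (≢-sym y≢c) (≢-sym y≢e)
        (two (≢-sym y≢c) x≢c) (two (≢-sym y≢e) x≢e))
      conclude (yes refl) _ = too-many (triangle-bound xa xb ab (≢-sym y≢z) a≢c b≢c (two a≢c x≢a) (two b≢c x≢b))
      conclude _ (yes refl) = too-many (triangle-bound xa xb ab (≢-sym y≢z) a≢e b≢e (two a≢e x≢a) (two b≢e x≢b))

  -- All vertices of the butterfly are saturated, so that a vertex t outside it
  -- has at most n − 6 neighbours.
  windmill-butterfly-free : 6 ≤ n → n ≤ 7 → ∀ {v R} → allFin n ↭ v ∷ R → degree G v ≡ 4 →
                            All (λ u → degree G u ≡ 2) R → ¬ Butterfly G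
  windmill-butterfly-free 6≤n n≤7 {v} {R} cover dv dR B@(butterfly-at {x} {a} {b} {c} {e} distinct xa xb xc xe ab ce)
    with ((x≢a ∷ x≢b ∷ x≢c ∷ x≢e ∷ []) ∷ (a≢b ∷ a≢c ∷ a≢e ∷ []) ∷ (b≢c ∷ b≢e ∷ []) ∷ (c≢e ∷ []) ∷ [] ∷ []) ← distinct =
    outside (complement distinct)
    where
    x≡v : x ≡ v
    x≡v with Perm.∈-resp-↭ cover (∈-allFin x)
    ... | here eq   = eq
    ... | there x∈R = contradiction (subst (4 ≤_) (All.lookup dR x∈R) (centre-degree B)) (λ { (s≤s (s≤s ())) })
    two : ∀ {u} → x ≢ u → degree G u ≡ 2
    two {u} x≢u with Perm.∈-resp-↭ cover (∈-allFin u)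
    ... | here eq   = contradiction (trans x≡v (sym eq)) x≢u
    ... | there u∈R = All.lookup dR u∈R
    outside : ∃ (λ rs → allFin n ↭ (x ∷ a ∷ b ∷ c ∷ e ∷ []) ++ rs × All (_∉ x ∷ a ∷ b ∷ c ∷ e ∷ []) rs) → ⊥
    outside ([] , p , _) = contradiction (subst (6 ≤_) (complement-length {xs = x ∷ a ∷ b ∷ c ∷ e ∷ []} p) 6≤n)
                             (λ { (s≤s (s≤s (s≤s (s≤s (s≤s ()))))) })
    outside (t ∷ _ , p , t∉ ∷ _) = contradiction
      (≤-trans (subst (_≤ n) (cong (6 +_) (two x≢t)) (nonneighbours+degree≤n G {t} {t ∷ x ∷ a ∷ b ∷ c ∷ e ∷ []}
        ((≢-sym x≢t ∷ ≢-sym a≢t ∷ ≢-sym b≢t ∷ ≢-sym c≢t ∷ ≢-sym e≢t ∷ []) ∷ distinct)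
        ( adj-irrefl G refl
        ∷ (λ tx → contradiction (subst (5 ≤_) (trans (cong (degree G) x≡v) dv)
             (neighbours≤degree G {x} {a ∷ b ∷ c ∷ e ∷ t ∷ []}
               ((a≢b ∷ a≢c ∷ a≢e ∷ a≢t ∷ []) ∷ (b≢c ∷ b≢e ∷ b≢t ∷ []) ∷ (c≢e ∷ c≢t ∷ []) ∷ (e≢t ∷ []) ∷ [] ∷ [])
               (xa ∷ xb ∷ xc ∷ xe ∷ adj-sym G tx ∷ []))) (λ { (s≤s (s≤s (s≤s (s≤s ())))) }))
        ∷ saturated (adj-sym G xa) ab x≢b (two x≢a) x≢t b≢t ∘ adj-sym G
        ∷ saturated (adj-sym G xb) (adj-sym G ab) x≢a (two x≢b) x≢t a≢t ∘ adj-sym G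
        ∷ saturated (adj-sym G xc) ce x≢e (two x≢c) x≢t e≢t ∘ adj-sym G
        ∷ saturated (adj-sym G xe) (adj-sym G ce) x≢c (two x≢e) x≢t c≢t ∘ adj-sym G
        ∷ []))) n≤7)
      (<⇒≱ ≤-refl)
      where
      x≢t : x ≢ t
      x≢t refl = t∉ (here refl)
      a≢t : a ≢ t
      a≢t refl = t∉ (there (here refl))
      b≢t : b ≢ t
      b≢t refl = t∉ (there (there (here refl)))
      c≢t : c ≢ t
      c≢t refl = t∉ (there (there (there (here refl))))
      e≢t : e ≢ t
      e≢t refl = t∉ (there (there (there (there (here refl)))))

-- The two spine degrees add up to at least `n + i`, all remaining terms only to
-- `2 * i + (n ∸ i ∸ 2)`, which is `n + i ∸ 2`. So the spine holds more than half of the total,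
-- against `two-degrees-bound`.
book-sum-small : ∀ n k i → 5 ≤ n → 1 ≤ k → 3 ≤ i → i ≤ n ∸ 2 * k →
                 ¬ 2 * ((n ∸ k) + (k + i)) ≤ (n ∸ k) + ((k + i) + (i * 2 + (n ∸ i ∸ 2) * 1))
book-sum-small n k i 5≤n 1≤k 3≤i i≤ le with m≤n⇒∃[o]m+o≡n i+2≤n
  where
  -- Allows writing `n` as `i + 2 + m`, where `m` is the number of ones.
  i+2≤n : i + 2 ≤ n
  i+2≤n = subst (i + 2 ≤_) (m∸n+n≡m {n} {2} (≤-trans (s≤s (s≤s z≤n)) 5≤n))
            (+-monoˡ-≤ 2 (≤-trans i≤ (∸-monoʳ-≤ n (*-monoʳ-≤ 2 1≤k))))
... | m , refl = contradiction (begin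
    suc (i + m + i)         ≤⟨ n≤1+n _ ⟩
    2 + (i + m + i)         ≡⟨ assemble i m ⟩
    -- An inequality suffices here and holds even if `n ∸ k` were truncated.
    (i + 2 + m) + i         ≤⟨ +-monoˡ-≤ i (m≤n+m∸n (i + 2 + m) k) ⟩
    k + (i + 2 + m ∸ k) + i ≡⟨ reorder k (i + 2 + m ∸ k) i ⟩
    S
      ≤⟨ +-cancelˡ-≤ S _ _ (≤-trans (≤-reflexive (cong (S +_) (sym (+-identityʳ S))))
                                    (≤-trans le (≤-reflexive split))) ⟩
    i * 2 + m * 1           ≡⟨ double i m ⟩
    i + m + i               ∎) (<⇒≱ ≤-refl)
  where
  open ≤-Reasoning
  S : ℕ
  S = (i + 2 + m ∸ k) + (k + i)
  assemble : ∀ i m → 2 + (i + m + i) ≡ (i + 2 + m) + i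
  assemble = solve-∀
  reorder : ∀ k p i → k + p + i ≡ p + (k + i)
  reorder = solve-∀
  double : ∀ i m → i * 2 + m * 1 ≡ i + m + i
  double = solve-∀
  leaves : i + 2 + m ∸ i ∸ 2 ≡ m
  leaves = trans (∸-+-assoc (i + 2 + m) i 2) (m+n∸m≡n (i + 2) m)
  split : (i + 2 + m ∸ k) + ((k + i) + (i * 2 + (i + 2 + m ∸ i ∸ 2) * 1)) ≡ S + (i * 2 + m * 1)
  split = trans (sym (+-assoc (i + 2 + m ∸ k) (k + i) _)) (cong (λ j → S + (i * 2 + j * 1)) leaves)

module _ {n} (5≤n : 5 ≤ n) {π : Vec ℕ n} (π↘ : NonIncreasing π) where

  necessary : Potentially K₅-C₄ -Graphic π → Conditions 5≤n π↘
  necessary (G , real@(ρ , eq) , K⊑G) = c₁ , c₂ , c₃ , c₄ , c₅ , c₆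
    where
    B : Butterfly G
    B = ⊑⇒Butterfly K⊑G
    open Butterfly B using (x)
    zeroth : toℕ (inject≤ 0F 5≤n) ≡ 0
    zeroth = toℕ-inject≤ 0F 5≤n
    c₁ : lookup π (inject≤ 0F 5≤n) ≥ 4
    c₁ = ≤-trans (subst (4 ≤_) (sym (eq x)) (centre-degree G B))
           (lookup-antitone π↘ (subst (_≤ toℕ (ρ ⟨$⟩ʳ x)) (sym zeroth) z≤n))

    -- By pigeonhole, some vertex of the butterfly is not among the first four terms.
    c₂ : lookup π (inject≤ 4F 5≤n) ≥ 2
    c₂ with 2 ≤? lookup π (inject≤ 4F 5≤n)
    ... | yes le = le
    ... | no ¬le = ⊥-elim clash
      where
      f : Fin 5 → Fin n
      f = proj₁ K⊑G
      heavy-f : ∀ i → 2 ≤ degree G (f i)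
      heavy-f 0F = All.lookup (butterfly-degrees G B) (there (here refl))
      heavy-f 1F = All.lookup (butterfly-degrees G B) (there (there (there (here refl))))
      heavy-f 2F = All.lookup (butterfly-degrees G B) (there (there (here refl)))
      heavy-f 3F = All.lookup (butterfly-degrees G B) (there (there (there (there (here refl)))))
      heavy-f 4F = All.lookup (butterfly-degrees G B) (here refl)
      early : ∀ i → toℕ (ρ ⟨$⟩ʳ f i) < 4
      early i = ≰⇒> λ 4≤ → ¬le (≤-trans (subst (2 ≤_) (sym (eq (f i))) (heavy-f i))
                  (lookup-antitone π↘ (subst (_≤ toℕ (ρ ⟨$⟩ʳ f i)) (sym (toℕ-inject≤ 4F 5≤n)) 4≤)))
      clash : ⊥
      clash with pigeonhole ≤-refl (λ i → fromℕ< (early i))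
      ... | i , j , i<j , e = <⇒≢ i<j (cong toℕ (proj₁ (proj₂ K⊑G) (permuted-injective ρ
              (toℕ-injective (fromℕ<-injective _ _ (early i) (early j) e)))))

    -- Lists the vertices in the order of the given sequence, so that those of the leading terms can
    -- be named by matching.
    vertices : ∀ {xs} → toList π ≡ xs → ∃ λ us → xs ≡ map (degree G) us × allFin n ↭ us
    vertices refl = Perm.↭-map-inv (degree G) (↭-sym (realized-degrees {G = G} real))

    constant : ∀ {c} k {us} → replicate k c ≡ map (degree G) us → All (λ u → degree G u ≡ c) us
    constant zero    {[]}     _ = []
    constant (suc k) {u ∷ us} e = let e₁ , e₂ = ∷-injective e in sym e₁ ∷ constant k e₂

    c₃ : n ≥ 6 → toList π ≢ replicate 2 (n ∸ 2) ++ replicate (n ∸ 2) 2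
    c₃ n≥6 e with vertices e
    ... | v ∷ w ∷ us , e′ , cover =
      let dv , e″ = ∷-injective e′
          dw , e‴ = ∷-injective e″
      in  spindle-butterfly-free G n≥6 cover (sym dv) (sym dw) (constant (n ∸ 2) e‴) B

    c₄ : ∀ k i → 1 ≤ k → k ≤ (n ∸ 1) / 2 ∸ 1 → 3 ≤ i → i ≤ n ∸ 2 * k →
         toList π ≢ (n ∸ k) ∷ (k + i) ∷ replicate i 2 ++ replicate (n ∸ i ∸ 2) 1
    c₄ k i 1≤k _ 3≤i i≤ e with vertices e
    ... | v ∷ w ∷ us , e′ , cover with edge-avoiding G B v w
    ... | s , t , st , s∉ , t∉ = book-sum-small n k i 5≤n 1≤k 3≤i i≤
      (subst₂ _≤_ (cong (2 *_) (cong₂ _+_ (sym dv) (sym dw))) total (two-degrees-bound G v≢w st s∉ t∉))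
      where
      dv : n ∸ k ≡ degree G v
      dv = proj₁ (∷-injective e′)
      dw : k + i ≡ degree G w
      dw = proj₁ (∷-injective (proj₂ (∷-injective e′)))
      v≢w : v ≢ w
      v≢w with (v≢w ∷ _) ∷ _ ← PermSetoid.Unique-resp-↭ (setoid _) (↭⇒↭ₛ cover) (UniqueP.allFin⁺ n) = v≢w
      total : ∑ (degree G) (allFin n) ≡ (n ∸ k) + ((k + i) + (i * 2 + (n ∸ i ∸ 2) * 1))
      total = trans (∑-↭ (degree G) cover) (trans (cong sum (sym e′))
        (cong (λ r → (n ∸ k) + ((k + i) + r)) (trans (sum-++ (replicate i 2) _)
          (cong₂ _+_ (sum-replicate i 2) (sum-replicate (n ∸ i ∸ 2) 1)))))

    windmill : ∀ m → 6 ≤ n → n ≤ 7 → toList π ≢ 4 ∷ replicate m 2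
    windmill m 6≤n n≤7 e with vertices e
    ... | v ∷ us , e′ , cover =
      let dv , e″ = ∷-injective e′
      in  windmill-butterfly-free G 6≤n n≤7 cover (sym dv) (constant m e″) B

    c₅ : n ≡ 6 → toList π ≢ 4 ∷ replicate 5 2
    c₅ refl = windmill 5 ≤-refl (n≤1+n 6)

    c₆ : n ≡ 7 → toList π ≢ 4 ∷ replicate 6 2
    c₆ refl = windmill 6 (n≤1+n 6) ≤-refl

theorem3p1 : (n : ℕ) (5≤n : 5 ≤ n) (π : Vec ℕ n) →
    NonIncreasing π → VecAll.All (_> 0) π → Graphic π →
    Potentially K₅-C₄ -Graphic π ⇔
    ( lookup π (inject≤ 0F 5≤n) ≥ 4
    × lookup π (inject≤ 4F 5≤n) ≥ 2
    × (n ≥ 6 → toList π ≢ replicate 2 (n ∸ 2) ++ replicate (n ∸ 2) 2)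
    × (∀ k i → 1 ≤ k → k ≤ (n ∸ 1) / 2 ∸ 1 → 3 ≤ i → i ≤ n ∸ 2 * k →
    toList π ≢ (n ∸ k) ∷ (k + i) ∷ replicate i 2 ++ replicate (n ∸ i ∸ 2) 1)
    × (n ≡ 6 → toList π ≢ 4 ∷ replicate 5 2)
    × (n ≡ 7 → toList π ≢ 4 ∷ replicate 6 2)
    )
theorem3p1 n 5≤n π π↘ π>0 graphic = mk⇔ (necessary 5≤n π↘) (sufficient 5≤n π↘ π>0 graphic)
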